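{- (i) For integers $k\ge 2$, $\ell$ and $n$ with $\ell \le n$ and $\ell \geq \log_2(2k)$, we have $\mathbf{d}(Q_n, Q_\ell, C_{2k}) = 0$. (ii) For each integer $k \geq 4$ with $k \neq 5$ there is a positive constant $c_k$ such that for all integers $\ell, n$ with $2 \leq \ell < \log_2(2k) \leq n$, setting $m := \lceil \log_2(2k) \rceil -1$, \[ \binom{m}{\ell}\binom{n}{\ell}^{ -1} \leq \mathbf{d}(Q_n, Q_\ell, C_{2k}) \leq c_k\, n^{ -\frac{1}{16}}.\]
   Context: $Q_n$ denotes the $n$-dimensional hypercube: its vertices are the binary vectors of length $n$, two vectors being adjacent iff they differ in exactly one coordinate. $C_m$ is the cycle on $m$ vertices. For graphs $G$ and $T$, a copy of $T$ in $G$ is a subgraph of $G$ isomorphic to $T$, and $N(G,T)$ is the number of copies of $T$ in $G$. A graph is $H$-free if it has no subgraph isomorphic to $H$. For subgraphs $T,H$ of $G$, $\mathrm{ex}(G,T,H)=\max\{N(G',T): G'\subseteq G,\ G' \text{ is } H\text{ -free}\}$ and $\mathbf{d}(G,T,H)=\mathrm{ex}(G,T,H)/N(G,T)$. -}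

module Defs where

open import Data.Bool using (Bool; true; false; _∧_; _∨_; if_then_else_)
open import Data.Nat as ℕ using (ℕ; zero; suc; _≡ᵇ_; _≤_)
open import Data.Fin using (Fin; toℕ)
open import Data.Vec using (Vec; []; _∷_)
open import Data.Product using (Σ; _×_; _,_; proj₁)
open import Data.Empty using (⊥)
open import Relation.Nullary using (¬_)
open import Relation.Binary using (Setoid; IsEquivalence)
open import Relation.Binary.PropositionalEquality as ≡ using (_≡_)
open import Function.Bundles using (Inverse; _↔_)
open import Data.Integer using (+_)
open import Data.Rational as ℚ using (ℚ)

record Graph : Set₁ where
  field
    V   : Set
    adj : V → V → Bool
open Graph public

hamming : ∀ {n} → Vec Bool n → Vec Bool n → ℕ
hamming [] [] = 0
hamming (x ∷ xs) (y ∷ ys) = (if eqB x y then 0 else 1) ℕ.+ hamming xs ys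
  where
  eqB : Bool → Bool → Bool
  eqB true true = true
  eqB false false = true
  eqB _ _ = false

Q : ℕ → Graph
Q n = record { V = Vec Bool n ; adj = λ u v → hamming u v ≡ᵇ 1 }

-- Cycle C_m on vertex set Fin m (i ~ i+1 mod m); used with m ≥ 3.
Cyc : ℕ → Graph
Cyc m = record { V = Fin m ; adj = λ i j → ad (toℕ i) (toℕ j) }
  where
  ad : ℕ → ℕ → Bool
  ad a b = (suc a ≡ᵇ b) ∨ (suc b ≡ᵇ a)
         ∨ ((a ≡ᵇ 0) ∧ (suc b ≡ᵇ m)) ∨ ((b ≡ᵇ 0) ∧ (suc a ≡ᵇ m))

record Subgraph (G : Graph) : Set where
  field
    vs     : V G → Bool
    es     : V G → V G → Bool
    es-sym : ∀ u v → es u v ≡ es v u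
    es-adj : ∀ u v → es u v ≡ true → adj G u v ≡ true
    es-vs  : ∀ u v → es u v ≡ true → vs u ≡ true
open Subgraph public

asGraph : ∀ {G} → Subgraph G → Graph
asGraph {G} S = record
  { V = Σ (V G) (λ v → vs S v ≡ true)
  ; adj = λ u v → es S (proj₁ u) (proj₁ v) }

record _≅_ (G H : Graph) : Set where
  field
    bij  : V G ↔ V H
    pres : ∀ u v → adj G u v ≡ adj H (Inverse.to bij u) (Inverse.to bij v)

CopySetoid : Graph → Graph → Setoid _ _
CopySetoid G T = record
  { Carrier = Σ (Subgraph G) (λ S → asGraph S ≅ T)
  ; _≈_ = λ A B → (∀ v → vs (proj₁ A) v ≡ vs (proj₁ B) v)
                × (∀ u v → es (proj₁ A) u v ≡ es (proj₁ B) u v)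
  ; isEquivalence = record
    { refl = (λ _ → ≡.refl) , (λ _ _ → ≡.refl)
    ; sym = λ (p , q) → (λ v → ≡.sym (p v)) , (λ u v → ≡.sym (q u v))
    ; trans = λ (p , q) (p' , q') → (λ v → ≡.trans (p v) (p' v))
                                  , (λ u v → ≡.trans (q u v) (q' u v)) } }

HasCount : Graph → Graph → ℕ → Set
HasCount G T m = Inverse (≡.setoid (Fin m)) (CopySetoid G T)

Free : Graph → Graph → Set
Free G H = ¬ Σ (Subgraph G) (λ S → asGraph S ≅ H)

IsEx : Graph → Graph → Graph → ℕ → Set
IsEx G T H e =
  Σ (Subgraph G) (λ S → Free (asGraph S) H × HasCount (asGraph S) T e)
  × (∀ (S : Subgraph G) m → Free (asGraph S) H → HasCount (asGraph S) T m → m ≤ e)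

IsDensity : Graph → Graph → Graph → ℚ → Set
IsDensity G T H q =
  Σ ℕ λ e → Σ ℕ λ N → IsEx G T H e × HasCount G T N
    × Σ (ℕ.NonZero N) (λ nz → q ≡ ℚ._/_ (+ e) N {{nz}})

_^ℚ_ : ℚ → ℕ → ℚ
q ^ℚ zero = ℚ.1ℚ
q ^ℚ suc n = q ℚ.* (q ^ℚ n)

ℕ→ℚ : ℕ → ℚ
ℕ→ℚ n = ℚ._/_ (+ n) 1

{-# OPTIONS --safe #-}

-- A subgraph of Q n isomorphic to Q ℓ is a subcube, so copies of Q ℓ are counted by counting
-- subcubes, of which Q n has (n C ℓ) * 2 ^ (n ∸ ℓ).  Every Q ℓ with 2 ^ ℓ ≥ 2k contains a
-- 2k-cycle, and the union of all parallel copies of Q m with 2 ^ m < 2k contains none, which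
-- gives (i) and the lower bound.  For the upper bound fix a vertex x and join two directions
-- i, j when the square through x in these directions lies in the subgraph.  A path i₀ … i_p of
-- this graph yields the cycle x, x+i₀, x+i₀+i₁, x+i₁, …, x+i_p of length 2p + 2.  Hence for
-- p = k ∸ 1 there is no such path, so the graph on directions is degenerate and has at most
-- n * 2 ^ p nonempty cliques.  A subcube through x is determined by its directions, which form a
-- clique; averaging over x shows that the density is even O(1 / n).
module Submission where

open import Defs
open import Data.Nat using (ℕ; _≤_; _<_; _*_; _^_; _∸_)
open import Data.Nat.Combinatorics using (_C_; nCk+nC[k+1]≡[n+1]C[k+1])
open import Data.Nat.Logarithm using (⌈log₂_⌉; ⌈log₂⌉-mono-≤; ⌈log₂2^n⌉≡n)
open import Data.Product using (Σ; ∃; ∃₂; _×_; _,_; proj₁; proj₂)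
open import Relation.Binary.PropositionalEquality using (_≢_)
open import Data.Rational as ℚ using (ℚ; 0ℚ; Positive)

open import Data.Bool using (Bool; true; false; not; _∧_; _∨_; T)
import Data.Bool.Properties as Bool
open import Data.Fin as Fin using (Fin; zero; suc; toℕ)
open import Data.Fin.Induction using (<-weakInduction)
open import Data.Fin.Permutation using (↔⇒≡)
import Data.Fin.Properties as Fin
open import Data.Integer as ℤ using ()
import Data.Integer.Properties as ℤ
open import Data.List
  using (List; []; _∷_; _++_; length; map; filter; lookup; take; allFin
        ; cartesianProduct; cartesianProductWith)
open import Data.List.Membership.Propositional using (_∈_; lose; find)
open import Data.List.Membership.Propositional.Properties
  using (∈-++⁺ˡ; ∈-++⁺ʳ; ∈-++⁻; ∈-map⁺; ∈-map⁻; ∈-lookup; ∈-filter⁺; ∈-filter⁻; ∈-allFin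
        ; ∈-cartesianProduct⁻; ∈-cartesianProductWith⁺; ∈-cartesianProductWith⁻)
import Data.List.Membership.Setoid.Properties as Setoid∈
open import Data.List.Properties
  using (length-map; length-++; length-filter; length-take; length-tabulate
        ; filter-all; filter-notAll; take-[])
open import Data.List.Relation.Unary.All as All using (All; []; _∷_)
import Data.List.Relation.Unary.All.Properties as All
open import Data.List.Relation.Unary.AllPairs using ([]; _∷_)
open import Data.List.Relation.Unary.Any as Any using (Any; here; there; any?)
import Data.List.Relation.Unary.Any.Properties as Any
open import Data.List.Relation.Unary.Unique.Propositional using (Unique)
import Data.List.Relation.Unary.Unique.Propositional.Properties as Unique
open import Data.Nat as ℕ using (zero; suc; _+_; z≤n; s≤s; _≡ᵇ_; NonZero)
import Data.Nat.Properties as ℕ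
open import Data.List.Extrema ℕ.≤-totalOrder using (argmax; argmax-all; f[xs]≤f[argmax])
open import Data.Nat.Tactic.RingSolver using (solve-∀)
import Data.Rational.Properties as ℚ
import Data.Rational.Unnormalised as ℚᵘ
import Data.Rational.Unnormalised.Properties as ℚᵘ
open import Data.Sum as Sum using (_⊎_; inj₁; inj₂)
open import Data.Unit using (tt)
open import Data.Vec as Vec using (Vec; []; _∷_)
import Data.Vec.Functional as F
import Data.Vec.Properties as Vec
open import Function using (_∘_; id; mk⇔; _↔_; Equivalence; Inverse; mk↔ₛ′)
open import Function.Construct.Composition using (inverse)
open import Function.Construct.Symmetry using () renaming (inverse to inverse-sym)
open import Relation.Binary using (Setoid; DecidableEquality)
open import Relation.Binary.PropositionalEquality
  using (_≡_; _≗_; refl; sym; trans; cong; cong₂; subst; subst₂; setoid; module ≡-Reasoning)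
open import Relation.Binary.PropositionalEquality.WithK using (≡-irrelevant)
open import Relation.Nullary using (¬_; ¬?; Dec; yes; no; does; contradiction; _×-dec_; _→-dec_; map′)
open import Relation.Nullary.Decidable using (dec-true)
open import Relation.Unary using (Decidable)

-- Where the exponent comes from: averaging gives `e * 2 ^ ℓ ≤ 2 ^ n * (n * 2 ^ (k ∸ 1))` for the
-- extremal number `e`, while the number `N` of all copies satisfies `N * 2 ^ ℓ ≡ 2 ^ n * (n C ℓ)`.
-- The density is thus at most `n * 2 ^ (k ∸ 1)` divided by `n C ℓ`. As `ℓ ≥ 2`, the binomial is at
-- least `n * n / (2 * ℓ * ℓ)`, and `ℓ < 2k` makes the constant independent of `ℓ`. Roots never
-- occur: the bound is stated between sixteenth powers.
--
-- Two obstacles shape the rest. A count is a bijection with a setoid of subgraphs, so each class of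
-- copies needs a canonical code; the rigidity of embeddings `Q ℓ ↪ Q n` supplies one, the subcube.
-- And the extremal number has to be attained by an explicit subgraph, so subgraphs are enumerated
-- and the existence of a cycle is decided by finite search.

private
  variable
    A B P : Set
    n ℓ m : ℕ

-- Duplicate-free lists and enumerations

witness : (p? : Dec P) → does p? ≡ true → P
witness (yes p) _ = p

bool-ext : {b c : Bool} → (b ≡ true → c ≡ true) → (c ≡ true → b ≡ true) → b ≡ c
bool-ext f g = Bool.⇔→≡ (mk⇔ f g)

lookup-injective : {xs : List A} → Unique xs → ∀ i j → lookup xs i ≡ lookup xs j → i ≡ j
lookup-injective (_ ∷ _) zero zero _ = refl
lookup-injective (x∉xs ∷ _) zero (suc j) eq = contradiction eq (All.lookup x∉xs (∈-lookup j))
lookup-injective (x∉xs ∷ _) (suc i) zero eq = contradiction (sym eq) (All.lookup x∉xs (∈-lookup i))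
lookup-injective (_ ∷ xs!) (suc i) (suc j) eq = cong suc (lookup-injective xs! i j eq)

unique⇒length≤ : {xs ys : List A} → Unique xs → (∀ {x} → x ∈ xs → x ∈ ys) → length xs ≤ length ys
unique⇒length≤ {A = A} {xs} xs! xs⊆ys = Fin.injective⇒≤ {f = λ i → Any.index (xs⊆ys (∈-lookup i))}
  λ {i} {j} eq → lookup-injective xs! i j
    (Setoid∈.index-injective (setoid A) (xs⊆ys (∈-lookup i)) (xs⊆ys (∈-lookup j)) eq)

filter-complement : {P : A → Set} (P? : Decidable P) (xs : List A) →
  length xs ≡ length (filter P? xs) + length (filter (¬? ∘ P?) xs)
filter-complement P? [] = refl
filter-complement P? (x ∷ xs) with P? x
... | yes _ = cong suc (filter-complement P? xs)
... | no _ = trans (cong suc (filter-complement P? xs)) (sym (ℕ.+-suc _ _))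

map-unique : {f : A → B} {xs : List A} →
  (∀ {x y} → x ∈ xs → y ∈ xs → f x ≡ f y → x ≡ y) → Unique xs → Unique (map f xs)
map-unique inj [] = []
map-unique {f = f} inj (x∉xs ∷ xs!) =
  All.tabulate (λ y∈ fx≡y → let (z , z∈ , y≡fz) = ∈-map⁻ f y∈ in
    All.lookup x∉xs z∈ (inj (here refl) (there z∈) (trans fx≡y y≡fz)))
  ∷ map-unique (λ x∈ y∈ → inj (there x∈) (there y∈)) xs!

-- Reduces a count to a duplicate-free list of codes. Elements of `X` are subgraphs compared
-- pointwise, so they are related to codes by `_describes_` and not by a function with inverse laws;
-- the last two hypotheses say that this relation matches codes with equivalence classes one to one.
enumerate : ∀ {c ℓ′} {X : Setoid c ℓ′} {L : List A} (_describes_ : A → Setoid.Carrier X → Set) →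
  Unique L →
  (∀ {a} → a ∈ L → Σ (Setoid.Carrier X) (a describes_)) →
  (∀ x → ∃ λ a → a ∈ L × a describes x) →
  (∀ {a x y} → a describes x → a describes y → Setoid._≈_ X x y) →
  (∀ {a b x y} → a ∈ L → b ∈ L → Setoid._≈_ X x y → a describes x → b describes y → a ≡ b) →
  Inverse (setoid (Fin (length L))) X
enumerate {X = X} {L} _describes_ L! build code sound complete = record
  { to = λ i → proj₁ (build (∈-lookup i))
  ; from = λ x → Any.index (proj₁ (proj₂ (code x)))
  ; to-cong = λ { refl → X.refl }
  ; from-cong = λ {x} {y} x≈y → lookup-injective L! _ _
      (trans (sym (at-index (proj₁ (proj₂ (code x)))))
        (trans (complete (proj₁ (proj₂ (code x))) (proj₁ (proj₂ (code y))) x≈y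
                         (proj₂ (proj₂ (code x))) (proj₂ (proj₂ (code y))))
               (at-index (proj₁ (proj₂ (code y))))))
  ; inverse = (λ { {x} refl → to-from x })
            , (λ {i} {x} x≈ → lookup-injective L! _ _
                (trans (sym (at-index (proj₁ (proj₂ (code x)))))
                  (complete (proj₁ (proj₂ (code x))) (∈-lookup i) x≈
                    (proj₂ (proj₂ (code x))) (proj₂ (build (∈-lookup i))))))
  }
  where
  module X = Setoid X
  at-index : ∀ {a} (p : a ∈ L) → a ≡ lookup L (Any.index p)
  at-index p = Any.lookup-index p
  to-from : ∀ x → proj₁ (build (∈-lookup (Any.index (proj₁ (proj₂ (code x)))))) X.≈ x
  to-from x with code x
  ... | a , a∈L , d = sound (proj₂ (build (∈-lookup (Any.index a∈L))))
                            (subst (_describes x) (at-index a∈L) d)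

-- Hypercube vertices, embeddings and copies

Vertex : ℕ → Set
Vertex = Vec Bool

vertices : ∀ n → List (Vertex n)
vertices zero = [] ∷ []
vertices (suc n) = map (true ∷_) (vertices n) ++ map (false ∷_) (vertices n)

∈-vertices : (v : Vertex n) → v ∈ vertices n
∈-vertices [] = here refl
∈-vertices (true ∷ v) = ∈-++⁺ˡ (∈-map⁺ _ (∈-vertices v))
∈-vertices (false ∷ v) = ∈-++⁺ʳ _ (∈-map⁺ _ (∈-vertices v))

vertices-unique : ∀ n → Unique (vertices n)
vertices-unique zero = [] ∷ []
vertices-unique (suc n) = Unique.++⁺
  (Unique.map⁺ Vec.∷-injectiveʳ (vertices-unique n))
  (Unique.map⁺ Vec.∷-injectiveʳ (vertices-unique n))
  λ (p , q) → let (_ , _ , e) = ∈-map⁻ _ p ; (_ , _ , e′) = ∈-map⁻ _ q in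
    contradiction (Vec.∷-injectiveˡ (trans (sym e) e′)) λ ()

length-vertices : ∀ n → length (vertices n) ≡ 2 ^ n
length-vertices zero = refl
length-vertices (suc n) = begin
  length (map (true ∷_) (vertices n) ++ map (false ∷_) (vertices n))
    ≡⟨ length-++ (map (true ∷_) (vertices n)) ⟩
  length (map (true ∷_) (vertices n)) + length (map (false ∷_) (vertices n))
    ≡⟨ cong₂ _+_ (length-map _ (vertices n)) (length-map _ (vertices n)) ⟩
  length (vertices n) + length (vertices n)
    ≡⟨ cong₂ _+_ (length-vertices n) (trans (length-vertices n) (sym (ℕ.+-identityʳ _))) ⟩
  2 ^ suc n ∎
  where open ≡-Reasoning

_≟ᵛ_ : DecidableEquality (Vertex n)
_≟ᵛ_ = Vec.≡-dec Bool._≟_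

-- Edges are preserved but not reflected, because a copy in a graph need not be an induced subgraph.
record _↪_ (T G : Graph) : Set where
  field
    at : V T → V G
    injective : ∀ {s t} → at s ≡ at t → s ≡ t
    homo : ∀ {s t} → adj T s t ≡ true → adj G (at s) (at t) ≡ true
open _↪_

_∘↪_ : {T G H : Graph} → G ↪ H → T ↪ G → T ↪ H
g ∘↪ f = record
  { at = at g ∘ at f
  ; injective = injective f ∘ injective g
  ; homo = homo g ∘ homo f }

record IsCopyOf {T G : Graph} (f : T ↪ G) (S : Subgraph G) : Set where
  field
    vs⇒ : ∀ {u} → vs S u ≡ true → ∃ λ t → at f t ≡ u
    vs⇐ : ∀ t → vs S (at f t) ≡ true
    es⇒ : ∀ {u v} → es S u v ≡ true → ∃₂ λ s t → adj T s t ≡ true × at f s ≡ u × at f t ≡ v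
    es⇐ : ∀ {s t} → adj T s t ≡ true → es S (at f s) (at f t) ≡ true

vs-irrelevant : {G : Graph} (S : Subgraph G) {u v : V (asGraph S)} → proj₁ u ≡ proj₁ v → u ≡ v
vs-irrelevant S {_ , p} {_ , q} refl = cong (_ ,_) (≡-irrelevant p q)

copy⇒embedding : {T G : Graph} (X : Σ (Subgraph G) (λ S → asGraph S ≅ T)) →
  Σ (T ↪ G) λ f → IsCopyOf f (proj₁ X)
copy⇒embedding {T} {G} (S , iso) = f , record
  { vs⇒ = λ {u} p → to (u , p) , cong proj₁ (strictlyInverseʳ (u , p))
  ; vs⇐ = λ t → proj₂ (from t)
  ; es⇒ = λ {u} {v} e → let u∈ = es-vs S u v e ; v∈ = es-vs S v u (trans (es-sym S v u) e) in
      to (u , u∈) , to (v , v∈) , trans (sym (pres (u , u∈) (v , v∈))) e ,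
      cong proj₁ (strictlyInverseʳ (u , u∈)) , cong proj₁ (strictlyInverseʳ (v , v∈))
  ; es⇐ = es-from }
  where
  open _≅_ iso
  open Inverse bij using (to; from; strictlyInverseˡ; strictlyInverseʳ)
  es-from : ∀ {s t} → adj T s t ≡ true → es S (proj₁ (from s)) (proj₁ (from t)) ≡ true
  es-from {s} {t} e = trans (pres (from s) (from t))
    (trans (cong₂ (adj T) (strictlyInverseˡ s) (strictlyInverseˡ t)) e)
  f : T ↪ G
  f = record
    { at = proj₁ ∘ from
    ; injective = λ {s} {t} eq → trans (sym (strictlyInverseˡ s))
        (trans (cong to (vs-irrelevant S eq)) (strictlyInverseˡ t))
    ; homo = λ e → es-adj S _ _ (es-from e) }

module _ {T G : Graph} (L : List (V T)) (complete : ∀ t → t ∈ L) (_≟_ : DecidableEquality (V G))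
  (T-sym : ∀ s t → adj T s t ≡ adj T t s) (f : T ↪ G) where

  private
    image? : ∀ u → Dec (∃ λ t → at f t ≡ u)
    image? u = map′ Any.satisfied (λ (t , eq) → lose (complete t) eq) (any? (λ t → at f t ≟ u) L)

    ImageEdge : V G → V G → Set
    ImageEdge u v = ∃₂ λ s t → adj T s t ≡ true × at f s ≡ u × at f t ≡ v

    imageEdge? : ∀ u v → Dec (ImageEdge u v)
    imageEdge? u v = map′
      (λ p → let (s , q) = Any.satisfied p ; (t , r) = Any.satisfied q in s , t , r)
      (λ (s , t , r) → lose (complete s) (lose (complete t) r))
      (any? (λ s → any? (λ t → (adj T s t Bool.≟ true) ×-dec (at f s ≟ u) ×-dec (at f t ≟ v)) L) L)

    imageEdge-sym : ∀ {u v} → ImageEdge u v → ImageEdge v u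
    imageEdge-sym (s , t , e , p , q) = t , s , trans (T-sym t s) e , q , p

    image : Subgraph G
    image = record
      { vs = λ u → does (image? u)
      ; es = λ u v → does (imageEdge? u v)
      ; es-sym = λ u v → bool-ext
          (λ e → dec-true (imageEdge? v u) (imageEdge-sym (witness (imageEdge? u v) e)))
          (λ e → dec-true (imageEdge? u v) (imageEdge-sym (witness (imageEdge? v u) e)))
      ; es-adj = λ u v e → let (s , t , st , p , q) = witness (imageEdge? u v) e in
          subst₂ (λ u v → adj G u v ≡ true) p q (homo f st)
      ; es-vs = λ u v e → let (s , _ , _ , p , _) = witness (imageEdge? u v) e in
          dec-true (image? u) (s , p) }

    preimage : (u : V (asGraph image)) → ∃ λ t → at f t ≡ proj₁ u
    preimage (u , p) = witness (image? u) p

    bijection : V (asGraph image) ↔ V T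
    bijection = mk↔ₛ′ (proj₁ ∘ preimage) (λ t → at f t , dec-true (image? (at f t)) (t , refl))
      (λ t → injective f (proj₂ (preimage (at f t , dec-true (image? (at f t)) (t , refl)))))
      (λ u → vs-irrelevant image (proj₂ (preimage u)))

  -- The copy is the image of `f`. Subgraphs are Boolean-valued, so membership in the image must be
  -- decided, which is done by searching the list `L` of all vertices of `T`.
  embedding⇒copy : Σ (Subgraph G) (λ S → asGraph S ≅ T)
  embedding⇒copy = image , record
    { bij = bijection
    ; pres = λ u v → bool-ext
        (λ e → let (s , t , st , p , q) = witness (imageEdge? (proj₁ u) (proj₁ v)) e in
          subst₂ (λ s t → adj T s t ≡ true)
            (injective f (trans p (sym (proj₂ (preimage u)))))
            (injective f (trans q (sym (proj₂ (preimage v))))) st)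
        (λ e → dec-true (imageEdge? (proj₁ u) (proj₁ v))
          (_ , _ , e , proj₂ (preimage u) , proj₂ (preimage v))) }

  embedding⇒copy-isCopy : IsCopyOf f (proj₁ embedding⇒copy)
  embedding⇒copy-isCopy = record
    { vs⇒ = witness (image? _)
    ; vs⇐ = λ t → dec-true (image? _) (t , refl)
    ; es⇒ = witness (imageEdge? _ _)
    ; es⇐ = λ e → dec-true (imageEdge? _ _) (_ , _ , e , refl , refl) }

-- Subcubes and their rigidity

infix 4 _~_
_~_ : Vertex n → Vertex n → Set
u ~ v = adj (Q _) u v ≡ true

hamming-refl : (v : Vertex n) → hamming v v ≡ 0
hamming-refl [] = refl
hamming-refl (true ∷ v) = hamming-refl v
hamming-refl (false ∷ v) = hamming-refl v

hamming-sym : (u v : Vertex n) → hamming u v ≡ hamming v u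
hamming-sym [] [] = refl
hamming-sym (true ∷ u) (true ∷ v) = hamming-sym u v
hamming-sym (true ∷ u) (false ∷ v) = cong suc (hamming-sym u v)
hamming-sym (false ∷ u) (true ∷ v) = cong suc (hamming-sym u v)
hamming-sym (false ∷ u) (false ∷ v) = hamming-sym u v

hamming≡0 : (u v : Vertex n) → hamming u v ≡ 0 → u ≡ v
hamming≡0 [] [] _ = refl
hamming≡0 (true ∷ u) (true ∷ v) eq = cong (true ∷_) (hamming≡0 u v eq)
hamming≡0 (false ∷ u) (false ∷ v) eq = cong (false ∷_) (hamming≡0 u v eq)

Q-sym : (u v : Vertex n) → adj (Q n) u v ≡ adj (Q n) v u
Q-sym u v = cong (_≡ᵇ 1) (hamming-sym u v)

not~ : ∀ b (u : Vertex n) → (b ∷ u) ~ (not b ∷ u)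
not~ true u = cong (λ k → suc k ≡ᵇ 1) (hamming-refl u)
not~ false u = cong (λ k → suc k ≡ᵇ 1) (hamming-refl u)

∷~ : ∀ b (u v : Vertex n) → u ~ v → (b ∷ u) ~ (b ∷ v)
∷~ true u v e = e
∷~ false u v e = e

toggle : Fin n → Vertex n → Vertex n
toggle i v = Vec.updateAt v i not

toggle-at : (i : Fin n) (v : Vertex n) → Vec.lookup (toggle i v) i ≡ not (Vec.lookup v i)
toggle-at i v = Vec.lookup∘updateAt i v

toggle-off : {i j : Fin n} → i ≢ j → (v : Vertex n) → Vec.lookup (toggle j v) i ≡ Vec.lookup v i
toggle-off i≢j v = Vec.lookup∘updateAt′ _ _ i≢j v

toggle-twice : (i : Fin n) (v : Vertex n) → toggle i (toggle i v) ≡ v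
toggle-twice i v = trans (Vec.updateAt-updateAt i v)
  (trans (Vec.updateAt-cong i Bool.not-involutive v) (Vec.updateAt-id i v))

toggle≢ : (i : Fin n) (v : Vertex n) → toggle i v ≢ v
toggle≢ i v eq = Bool.not-¬ refl (trans (cong (λ u → Vec.lookup u i) (sym eq)) (toggle-at i v))

~-toggle : (i : Fin n) (u : Vertex n) → u ~ toggle i u
~-toggle zero (b ∷ u) = not~ b u
~-toggle (suc i) (b ∷ u) = ∷~ b u _ (~-toggle i u)

~⇒toggle : (u v : Vertex n) → u ~ v → ∃ λ i → v ≡ toggle i u
~⇒toggle [] [] ()
~⇒toggle (true ∷ u) (true ∷ v) e = let (i , eq) = ~⇒toggle u v e in suc i , cong (true ∷_) eq
~⇒toggle (false ∷ u) (false ∷ v) e = let (i , eq) = ~⇒toggle u v e in suc i , cong (false ∷_) eq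
~⇒toggle (true ∷ u) (false ∷ v) e with hamming u v in eq
... | zero = zero , cong (false ∷_) (sym (hamming≡0 u v eq))
~⇒toggle (false ∷ u) (true ∷ v) e with hamming u v in eq
... | zero = zero , cong (true ∷_) (sym (hamming≡0 u v eq))

hamming-toggle : (i : Fin n) (u v : Vertex n) → hamming (toggle i u) (toggle i v) ≡ hamming u v
hamming-toggle zero (true ∷ u) (true ∷ v) = refl
hamming-toggle zero (true ∷ u) (false ∷ v) = refl
hamming-toggle zero (false ∷ u) (true ∷ v) = refl
hamming-toggle zero (false ∷ u) (false ∷ v) = refl
hamming-toggle (suc i) (true ∷ u) (true ∷ v) = hamming-toggle i u v
hamming-toggle (suc i) (true ∷ u) (false ∷ v) = cong suc (hamming-toggle i u v)
hamming-toggle (suc i) (false ∷ u) (true ∷ v) = cong suc (hamming-toggle i u v)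
hamming-toggle (suc i) (false ∷ u) (false ∷ v) = hamming-toggle i u v

-- Two vertices at distance two have exactly two common neighbours.
square : (a : Vertex n) {i j i′ j′ : Fin n} → i ≢ j → toggle i′ (toggle j a) ≢ a →
  toggle j′ (toggle i a) ≡ toggle i′ (toggle j a) → j′ ≡ j
square a {i} {j} {i′} {j′} i≢j ≢a eq with j′ Fin.≟ j
... | yes j′≡j = j′≡j
... | no j′≢j with i′ Fin.≟ j
...   | yes refl = contradiction (toggle-twice j a) ≢a
...   | no i′≢j = contradiction
        (begin
          Vec.lookup a j ≡⟨ toggle-off (i≢j ∘ sym) a ⟨
          Vec.lookup (toggle i a) j ≡⟨ toggle-off (j′≢j ∘ sym) (toggle i a) ⟨
          Vec.lookup (toggle j′ (toggle i a)) j ≡⟨ cong (λ v → Vec.lookup v j) eq ⟩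
          Vec.lookup (toggle i′ (toggle j a)) j ≡⟨ toggle-off (i′≢j ∘ sym) (toggle j a) ⟩
          Vec.lookup (toggle j a) j ≡⟨ toggle-at j a ⟩
          not (Vec.lookup a j) ∎)
        (Bool.not-¬ refl)
  where open ≡-Reasoning

-- Connectedness of the hypercube: the tails are exchanged within one face, and then the first
-- coordinate.
locally-constant : (d : Vertex ℓ → A) → (∀ s t → s ~ t → d s ≡ d t) → ∀ s t → d s ≡ d t
locally-constant d const [] [] = refl
locally-constant d const (a ∷ s) (b ∷ t) =
  trans (locally-constant (d ∘ (a ∷_)) (λ s t s~t → const _ _ (∷~ a s t s~t)) s t) (change a b)
  where
  change : ∀ a b → d (a ∷ t) ≡ d (b ∷ t)
  change true true = refl
  change true false = const _ _ (not~ true t)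
  change false true = const _ _ (not~ false t)
  change false false = refl

-- Subcubes as words over 0, 1 and a star, with `ℓ` stars marking the free directions. Each subcube
-- has exactly one such word, which makes these words usable as codes.
data Cube : ℕ → ℕ → Set where
  []  : Cube 0 0
  _∷_ : Bool → Cube n ℓ → Cube (suc n) ℓ
  ✶∷_ : Cube n ℓ → Cube (suc n) (suc ℓ)

infixr 5 ✶∷_
infix 4 _∈ᶜ_

data _∈ᶜ_ : Vertex n → Cube n ℓ → Set where
  []  : [] ∈ᶜ []
  _∷_ : ∀ b {u : Vertex n} {c : Cube n ℓ} → u ∈ᶜ c → (b ∷ u) ∈ᶜ (b ∷ c)
  ✶∷_ : ∀ {b} {u : Vertex n} {c : Cube n ℓ} → u ∈ᶜ c → (b ∷ u) ∈ᶜ (✶∷ c)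

fill : Cube n ℓ → Vertex ℓ → Vertex n
fill [] [] = []
fill (b ∷ c) t = b ∷ fill c t
fill (✶∷ c) (b ∷ t) = b ∷ fill c t

fill-∈ : (c : Cube n ℓ) (t : Vertex ℓ) → fill c t ∈ᶜ c
fill-∈ [] [] = []
fill-∈ (b ∷ c) t = b ∷ fill-∈ c t
fill-∈ (✶∷ c) (b ∷ t) = ✶∷ fill-∈ c t

∈⇒fill : {c : Cube n ℓ} {u : Vertex n} → u ∈ᶜ c → ∃ λ t → fill c t ≡ u
∈⇒fill [] = [] , refl
∈⇒fill (b ∷ u∈) = let (t , eq) = ∈⇒fill u∈ in t , cong (b ∷_) eq
∈⇒fill (✶∷_ {b = b} u∈) = let (t , eq) = ∈⇒fill u∈ in b ∷ t , cong (b ∷_) eq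

fill-injective : (c : Cube n ℓ) {s t : Vertex ℓ} → fill c s ≡ fill c t → s ≡ t
fill-injective [] {[]} {[]} _ = refl
fill-injective (b ∷ c) eq = fill-injective c (Vec.∷-injectiveʳ eq)
fill-injective (✶∷ c) {_ ∷ _} {_ ∷ _} eq =
  cong₂ _∷_ (Vec.∷-injectiveˡ eq) (fill-injective c (Vec.∷-injectiveʳ eq))

hamming-fill : (c : Cube n ℓ) (s t : Vertex ℓ) → hamming (fill c s) (fill c t) ≡ hamming s t
hamming-fill [] [] [] = refl
hamming-fill (true ∷ c) s t = hamming-fill c s t
hamming-fill (false ∷ c) s t = hamming-fill c s t
hamming-fill (✶∷ c) (true ∷ s) (true ∷ t) = hamming-fill c s t
hamming-fill (✶∷ c) (true ∷ s) (false ∷ t) = cong suc (hamming-fill c s t)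
hamming-fill (✶∷ c) (false ∷ s) (true ∷ t) = cong suc (hamming-fill c s t)
hamming-fill (✶∷ c) (false ∷ s) (false ∷ t) = hamming-fill c s t

fill-adj : (c : Cube n ℓ) (s t : Vertex ℓ) → adj (Q n) (fill c s) (fill c t) ≡ adj (Q ℓ) s t
fill-adj c s t = cong (_≡ᵇ 1) (hamming-fill c s t)

cube-ext : (c c′ : Cube n ℓ) → (∀ {u} → u ∈ᶜ c → u ∈ᶜ c′) → (∀ {u} → u ∈ᶜ c′ → u ∈ᶜ c) → c ≡ c′
cube-ext [] [] _ _ = refl
cube-ext {ℓ = ℓ} (b ∷ c) (b′ ∷ c′) f g with f (b ∷ fill-∈ c (Vec.replicate ℓ true))
... | _ ∷ _ = cong (b ∷_) (cube-ext c c′ (λ u∈ → drop (f (b ∷ u∈))) (λ u∈ → drop (g (b ∷ u∈))))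
  where
  drop : ∀ {n ℓ b} {u : Vertex n} {c : Cube n ℓ} → (b ∷ u) ∈ᶜ (b ∷ c) → u ∈ᶜ c
  drop (_ ∷ u∈) = u∈
-- A star admits both bits, so the vertex that starts with the bit opposite to the fixed one refutes
-- the inclusion.
cube-ext {ℓ = ℓ} (true ∷ c) (✶∷ c′) f g with g (✶∷_ {b = false} (fill-∈ c′ (Vec.replicate _ true)))
... | ()
cube-ext {ℓ = ℓ} (false ∷ c) (✶∷ c′) f g with g (✶∷_ {b = true} (fill-∈ c′ (Vec.replicate _ true)))
... | ()
cube-ext {ℓ = ℓ} (✶∷ c) (true ∷ c′) f g with f (✶∷_ {b = false} (fill-∈ c (Vec.replicate _ true)))
... | ()
cube-ext {ℓ = ℓ} (✶∷ c) (false ∷ c′) f g with f (✶∷_ {b = true} (fill-∈ c (Vec.replicate _ true)))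
... | ()
cube-ext (✶∷ c) (✶∷ c′) f g =
  cong ✶∷_ (cube-ext c c′ (λ u∈ → drop (f (✶∷_ {b = true} u∈))) (λ u∈ → drop (g (✶∷_ {b = true} u∈))))
  where
  drop : ∀ {n ℓ b} {u : Vertex n} {c : Cube n ℓ} → (b ∷ u) ∈ᶜ (✶∷ c) → u ∈ᶜ c
  drop (✶∷ u∈) = u∈

Fixes : Cube n ℓ → Fin n → Set
Fixes c i = ∀ {u v} → u ∈ᶜ c → v ∈ᶜ c → Vec.lookup u i ≡ Vec.lookup v i

Widening : Cube n ℓ → Fin n → Cube n (suc ℓ) → Set
Widening c i c′ = ∀ {u} → (u ∈ᶜ c′ → u ∈ᶜ c ⊎ toggle i u ∈ᶜ c) × (u ∈ᶜ c ⊎ toggle i u ∈ᶜ c → u ∈ᶜ c′)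

-- The letter at position `i` decides: a star makes the cube invariant under toggling `i`, and a
-- fixed letter can be overwritten by a star, which adjoins the translate of the cube.
star-or-fixed : (c : Cube n ℓ) (i : Fin n) →
  (∀ {u} → u ∈ᶜ c → toggle i u ∈ᶜ c) ⊎ (Fixes c i × ∃ (Widening c i))
star-or-fixed (b ∷ c) zero = inj₂ ((λ { (_ ∷ _) (_ ∷ _) → refl }) , ✶∷ c , (λ { (✶∷ u∈) → near b u∈ }) ,
  λ { (inj₁ (_ ∷ u∈)) → ✶∷ u∈ ; (inj₂ p) → far p })
  where
  near : ∀ b {b′ u} → u ∈ᶜ c → ((b′ ∷ u) ∈ᶜ (b ∷ c)) ⊎ (toggle zero (b′ ∷ u) ∈ᶜ (b ∷ c))
  near true {true} u∈ = inj₁ (true ∷ u∈)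
  near true {false} u∈ = inj₂ (true ∷ u∈)
  near false {true} u∈ = inj₂ (false ∷ u∈)
  near false {false} u∈ = inj₁ (false ∷ u∈)
  far : ∀ {b u} → toggle zero u ∈ᶜ (b ∷ c) → u ∈ᶜ (✶∷ c)
  far {u = _ ∷ _} (_ ∷ u∈) = ✶∷ u∈
star-or-fixed (✶∷ c) zero = inj₁ λ { (✶∷ u∈) → ✶∷ u∈ }
star-or-fixed (b ∷ c) (suc i) with star-or-fixed c i
... | inj₁ closed = inj₁ λ { (_ ∷ u∈) → _ ∷ closed u∈ }
... | inj₂ (fixed , c′ , widens) = inj₂
  ((λ { (_ ∷ u∈) (_ ∷ v∈) → fixed u∈ v∈ }) , b ∷ c′
  , (λ { (_ ∷ u∈) → Sum.map (_ ∷_) (_ ∷_) (proj₁ widens u∈) })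
  , λ { (inj₁ (_ ∷ u∈)) → _ ∷ proj₂ widens (inj₁ u∈) ; (inj₂ p) → far p })
  where
  far : ∀ {u} → toggle (suc i) u ∈ᶜ (b ∷ c) → u ∈ᶜ (b ∷ c′)
  far {u = _ ∷ _} (_ ∷ u∈) = _ ∷ proj₂ widens (inj₂ u∈)
star-or-fixed (✶∷ c) (suc i) with star-or-fixed c i
... | inj₁ closed = inj₁ λ { (✶∷ u∈) → ✶∷ closed u∈ }
... | inj₂ (fixed , c′ , widens) = inj₂
  ((λ { (✶∷ u∈) (✶∷ v∈) → fixed u∈ v∈ }) , ✶∷ c′
  , (λ { (✶∷ u∈) → Sum.map ✶∷_ ✶∷_ (proj₁ widens u∈) })
  , λ { (inj₁ (✶∷ u∈)) → ✶∷ proj₂ widens (inj₁ u∈) ; (inj₂ p) → far p })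
  where
  far : ∀ {u} → toggle (suc i) u ∈ᶜ (✶∷ c) → u ∈ᶜ (✶∷ c′)
  far {u = _ ∷ _} (✶∷ u∈) = ✶∷ proj₂ widens (inj₂ u∈)

-- `reflect` says that the image is induced: with `onto`, every edge of `Q n` inside the cube comes
-- from an edge of `Q ℓ`. The edges of a copy can therefore be read off from its cube.
record HasCubeImage (f : Q ℓ ↪ Q n) : Set where
  field
    cube : Cube n ℓ
    into : ∀ t → at f t ∈ᶜ cube
    onto : ∀ {u} → u ∈ᶜ cube → ∃ λ t → at f t ≡ u
    reflect : ∀ {s t} → at f s ~ at f t → s ~ t

point : (v : Vertex n) → ∃ λ (c : Cube n 0) → v ∈ᶜ c
point [] = [] , []
point (b ∷ v) = let (c , v∈) = point v in b ∷ c , b ∷ v∈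

point-∈ : {c : Cube n 0} {u v : Vertex n} → u ∈ᶜ c → v ∈ᶜ c → u ≡ v
point-∈ [] [] = refl
point-∈ (b ∷ u∈) (.b ∷ v∈) = cong (b ∷_) (point-∈ u∈ v∈)

face : Bool → Q ℓ ↪ Q (suc ℓ)
face b = record { at = b ∷_ ; injective = Vec.∷-injectiveʳ ; homo = λ {s} {t} → ∷~ b s t }

-- By the four-cycle property both faces are joined by edges of one direction, so the image of
-- the second face is a translate of the cube spanned by the first one.
cube-image : ∀ ℓ (f : Q ℓ ↪ Q n) → HasCubeImage f
cube-image zero f = record
  { cube = proj₁ (point (at f []))
  ; into = λ { [] → proj₂ (point (at f [])) }
  ; onto = λ u∈ → [] , point-∈ (proj₂ (point (at f []))) u∈
  ; reflect = λ { {[]} {[]} e → contradiction (trans (sym e) (cong (_≡ᵇ 1) (hamming-refl (at f [])))) λ () } }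
cube-image (suc ℓ) f = extend (star-or-fixed cube d)
  where
  f₀ = f ∘↪ face false
  f₁ = f ∘↪ face true
  open HasCubeImage (cube-image ℓ f₀)

  rung : ∀ t → ∃ λ i → at f₁ t ≡ toggle i (at f₀ t)
  rung t = ~⇒toggle _ _ (homo f {false ∷ t} {true ∷ t} (not~ false t))

  parallel : ∀ s t → s ~ t → proj₁ (rung s) ≡ proj₁ (rung t)
  parallel s t s~t =
    let (j , p) = ~⇒toggle _ _ (homo f₀ {s} {t} s~t)
        (j′ , q) = ~⇒toggle _ _ (homo f₁ {s} {t} s~t)
        (i , r) = rung s
        (i′ , r′) = rung t
        opposite : at f₁ t ≡ toggle j′ (toggle i (at f₀ s))
        opposite = trans q (cong (toggle j′) r)
    -- The four-cycle is `f₀ s`, `f₀ t`, `f₁ t`, `f₁ s`. The side conditions of `square` hold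
    -- because injectivity keeps the opposite corners apart: `f₀ t ≢ f₁ s` and `f₁ t ≢ f₀ s`.
    in sym (square (at f₀ s) {j} {i} {j′} {i′}
      (λ j≡i → contradiction (Vec.∷-injectiveˡ (injective f {false ∷ t} {true ∷ s}
        (trans p (trans (cong (λ k → toggle k (at f₀ s)) j≡i) (sym r))))) λ ())
      (λ eq → contradiction (Vec.∷-injectiveˡ (injective f {true ∷ t} {false ∷ s} (trans opposite eq))) λ ())
      (trans (cong (toggle i′) (sym p)) (trans (sym r′) opposite)))

  d = proj₁ (rung (Vec.replicate ℓ true))

  translate : ∀ t → at f₁ t ≡ toggle d (at f₀ t)
  translate t = trans (proj₂ (rung t))
    (cong (λ i → toggle i (at f₀ t)) (locally-constant (proj₁ ∘ rung) parallel t _))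

  translate-back : ∀ t → toggle d (at f₁ t) ≡ at f₀ t
  translate-back t = trans (cong (toggle d) (translate t)) (toggle-twice d _)

  extend : (∀ {u} → u ∈ᶜ cube → toggle d u ∈ᶜ cube) ⊎ (Fixes cube d × ∃ (Widening cube d)) →
    HasCubeImage f
  -- If `d` were a star of `cube`, the translate of a vertex of the first face would lie in the
  -- image of that face, so the two faces would meet.
  extend (inj₁ closed) =
    let (s , eq) = onto (closed (into (Vec.replicate ℓ true))) in
    contradiction (Vec.∷-injectiveˡ (injective f {false ∷ s} {true ∷ Vec.replicate ℓ true}
      (trans eq (sym (translate _))))) λ ()
  extend (inj₂ (fixed , c , widens)) = record
    { cube = c
    ; into = λ { (false ∷ t) → proj₂ widens (inj₁ (into t))
               ; (true ∷ t) → proj₂ widens (inj₂ (subst (_∈ᶜ cube) (sym (translate-back t)) (into t))) }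
    ; onto = λ u∈ → onto′ (proj₁ widens u∈)
    ; reflect = λ { {false ∷ s} {false ∷ t} e → reflect {s} {t} e
                  ; {true ∷ s} {true ∷ t} e → reflect {s} {t} (trans (sym
                      (cong (_≡ᵇ 1) (trans (cong₂ hamming (translate s) (translate t))
                        (hamming-toggle d (at f₀ s) (at f₀ t))))) e)
                  ; {false ∷ s} {true ∷ t} e → across s t e
                  ; {true ∷ s} {false ∷ t} e → trans (Q-sym (true ∷ s) (false ∷ t))
                      (across t s (trans (Q-sym (at f₀ t) (at f₁ s)) e)) } }
    where
    onto′ : ∀ {u} → u ∈ᶜ cube ⊎ toggle d u ∈ᶜ cube → ∃ λ t → at f t ≡ u
    onto′ (inj₁ u∈) = let (t , eq) = onto u∈ in false ∷ t , eq
    onto′ (inj₂ u∈) = let (t , eq) = onto u∈ in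
      true ∷ t , trans (translate t) (trans (cong (toggle d) eq) (toggle-twice d _))

    -- Corresponding vertices of the two faces differ at coordinate `d`, and on the first face that
    -- coordinate is constant. An edge between the faces must therefore change `d`, which makes it a
    -- rung.
    across : ∀ s t → at f₀ s ~ at f₁ t → (false ∷ s) ~ (true ∷ t)
    across s t e with ~⇒toggle _ _ e
    ... | i , eq with i Fin.≟ d
    ...   | yes refl = subst (λ t → (false ∷ s) ~ (true ∷ t)) (sym (Vec.∷-injectiveʳ (injective f (begin
            at f₀ t ≡⟨ translate-back t ⟨
            toggle d (at f₁ t) ≡⟨ cong (toggle d) eq ⟩
            toggle d (toggle d (at f₀ s)) ≡⟨ toggle-twice d _ ⟩
            at f₀ s ∎)))) (not~ false s)
      where open ≡-Reasoning
    ...   | no i≢d = contradiction (begin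
            Vec.lookup (at f₀ t) d ≡⟨ fixed (into t) (into s) ⟩
            Vec.lookup (at f₀ s) d ≡⟨ toggle-off (i≢d ∘ sym) (at f₀ s) ⟨
            Vec.lookup (toggle i (at f₀ s)) d ≡⟨ cong (λ v → Vec.lookup v d) eq ⟨
            Vec.lookup (at f₁ t) d ≡⟨ cong (λ v → Vec.lookup v d) (translate t) ⟩
            Vec.lookup (toggle d (at f₀ t)) d ≡⟨ toggle-at d (at f₀ t) ⟩
            not (Vec.lookup (at f₀ t) d) ∎) (Bool.not-¬ refl)
      where open ≡-Reasoning

-- Counting copies of cubes

cubes : ∀ n ℓ → List (Cube n ℓ)
cubes zero zero = [] ∷ []
cubes zero (suc ℓ) = []
cubes (suc n) zero = map (true ∷_) (cubes n zero) ++ map (false ∷_) (cubes n zero)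
cubes (suc n) (suc ℓ) =
  map ✶∷_ (cubes n ℓ) ++ map (true ∷_) (cubes n (suc ℓ)) ++ map (false ∷_) (cubes n (suc ℓ))

∈-cubes : (c : Cube n ℓ) → c ∈ cubes n ℓ
∈-cubes [] = here refl
∈-cubes {ℓ = zero} (true ∷ c) = ∈-++⁺ˡ (∈-map⁺ _ (∈-cubes c))
∈-cubes {ℓ = zero} (false ∷ c) = ∈-++⁺ʳ _ (∈-map⁺ _ (∈-cubes c))
∈-cubes {suc n} {suc ℓ} (true ∷ c) =
  ∈-++⁺ʳ (map ✶∷_ (cubes n ℓ)) (∈-++⁺ˡ (∈-map⁺ _ (∈-cubes c)))
∈-cubes {suc n} {suc ℓ} (false ∷ c) =
  ∈-++⁺ʳ (map ✶∷_ (cubes n ℓ)) (∈-++⁺ʳ (map (true ∷_) (cubes n (suc ℓ))) (∈-map⁺ _ (∈-cubes c)))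
∈-cubes (✶∷ c) = ∈-++⁺ˡ (∈-map⁺ _ (∈-cubes c))

map-disjoint : {C : Set} {f : A → C} {g : B → C} {xs : List A} {ys : List B} →
  (∀ x y → f x ≢ g y) → ∀ {z} → ¬ (z ∈ map f xs × z ∈ map g ys)
map-disjoint f≢g (p , q) = let (x , _ , e) = ∈-map⁻ _ p ; (y , _ , e′) = ∈-map⁻ _ q in
  f≢g x y (trans (sym e) e′)

cubes-unique : ∀ n ℓ → Unique (cubes n ℓ)
cubes-unique zero zero = [] ∷ []
cubes-unique zero (suc ℓ) = []
cubes-unique (suc n) zero = Unique.++⁺
  (Unique.map⁺ (λ { refl → refl }) (cubes-unique n zero))
  (Unique.map⁺ (λ { refl → refl }) (cubes-unique n zero))
  (map-disjoint λ _ _ ())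
cubes-unique (suc n) (suc ℓ) = Unique.++⁺
  (Unique.map⁺ (λ { refl → refl }) (cubes-unique n ℓ))
  (Unique.++⁺
    (Unique.map⁺ (λ { refl → refl }) (cubes-unique n (suc ℓ)))
    (Unique.map⁺ (λ { refl → refl }) (cubes-unique n (suc ℓ)))
    (map-disjoint λ _ _ ()))
  λ (p , q) → Sum.[ (λ r → map-disjoint (λ _ _ ()) (p , r)) , (λ r → map-disjoint (λ _ _ ()) (p , r)) ]
    (∈-++⁻ (map (true ∷_) (cubes n (suc ℓ))) q)

-- Both sides count pairs of a cube and a vertex in it, since such a pair is a vertex together with
-- `ℓ` directions. Multiplying by `2 ^ ℓ` avoids the exponent `n ∸ ℓ`; the induction is Pascal's
-- rule.
length-cubes : ∀ n ℓ → length (cubes n ℓ) * 2 ^ ℓ ≡ 2 ^ n * (n C ℓ)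
length-cubes zero zero = refl
length-cubes zero (suc ℓ) = refl
length-cubes (suc n) zero = begin
  length (map (true ∷_) L ++ map (false ∷_) L) * 1 ≡⟨ cong (_* 1) (length-++ (map (true ∷_) L)) ⟩
  (length (map (true ∷_) L) + length (map (false ∷_) L)) * 1
    ≡⟨ cong (_* 1) (cong₂ _+_ (length-map _ L) (length-map _ L)) ⟩
  (length L + length L) * 1 ≡⟨ double (length L) ⟩
  2 * (length L * 1) ≡⟨ cong (2 *_) (length-cubes n zero) ⟩
  2 * (2 ^ n * 1) ≡⟨ ℕ.*-assoc 2 (2 ^ n) 1 ⟨
  2 ^ suc n * (suc n C 0) ∎
  where
  open ≡-Reasoning
  L = cubes n zero
  double : ∀ a → (a + a) * 1 ≡ 2 * (a * 1)
  double = solve-∀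
length-cubes (suc n) (suc ℓ) = begin
  length (map ✶∷_ M ++ map (true ∷_) L ++ map (false ∷_) L) * 2 ^ suc ℓ
    ≡⟨ cong (_* 2 ^ suc ℓ) (trans (length-++ (map ✶∷_ M)) (cong₂ _+_ (length-map _ M)
        (trans (length-++ (map (true ∷_) L)) (cong₂ _+_ (length-map _ L) (length-map _ L))))) ⟩
  (length M + (length L + length L)) * (2 * 2 ^ ℓ) ≡⟨ expand (length M) (length L) (2 ^ ℓ) ⟩
  2 * (length M * 2 ^ ℓ) + 2 * (length L * 2 ^ suc ℓ)
    ≡⟨ cong₂ (λ a b → 2 * a + 2 * b) (length-cubes n ℓ) (length-cubes n (suc ℓ)) ⟩
  2 * (2 ^ n * (n C ℓ)) + 2 * (2 ^ n * (n C suc ℓ)) ≡⟨ collect (2 ^ n) (n C ℓ) (n C suc ℓ) ⟩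
  2 ^ suc n * (n C ℓ + n C suc ℓ) ≡⟨ cong (2 ^ suc n *_) (nCk+nC[k+1]≡[n+1]C[k+1] n ℓ) ⟩
  2 ^ suc n * (suc n C suc ℓ) ∎
  where
  open ≡-Reasoning
  L = cubes n (suc ℓ)
  M = cubes n ℓ
  expand : ∀ a b c → (a + (b + b)) * (2 * c) ≡ 2 * (a * c) + 2 * (b * (2 * c))
  expand = solve-∀
  collect : ∀ a b c → 2 * (a * b) + 2 * (a * c) ≡ 2 * a * (b + c)
  collect = solve-∀

Inside : Subgraph (Q n) → Cube n ℓ → Set
Inside S c = (∀ t → vs S (fill c t) ≡ true) × (∀ s t → s ~ t → es S (fill c s) (fill c t) ≡ true)

∀-vertices? : {P : Vertex n → Set} → (∀ v → Dec (P v)) → Dec (∀ v → P v)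
∀-vertices? {n} P? = map′ (λ ps v → All.lookup ps (∈-vertices v)) (λ p → All.tabulate (λ _ → p _))
  (All.all? P? (vertices n))

inside? : (S : Subgraph (Q n)) (c : Cube n ℓ) → Dec (Inside S c)
inside? S c = ∀-vertices? (λ t → vs S (fill c t) Bool.≟ true) ×-dec
  ∀-vertices? λ s → ∀-vertices? λ t →
    (adj (Q _) s t Bool.≟ true) →-dec (es S (fill c s) (fill c t) Bool.≟ true)

cubesIn : Subgraph (Q n) → ∀ ℓ → List (Cube n ℓ)
cubesIn {n} S ℓ = filter (inside? S) (cubes n ℓ)

-- `G` is `S` up to the names of vertices. Copies have to be counted both in `asGraph S`, whose
-- vertices carry membership proofs, and in `Q n` itself; this relation lets one count serve both.
record _Realizes_ (G : Graph) (S : Subgraph (Q n)) : Set where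
  field
    ι : V G → Vertex n
    ι-injective : ∀ {u v} → ι u ≡ ι v → u ≡ v
    ι-vs : ∀ u → vs S (ι u) ≡ true
    lift : ∀ v → vs S v ≡ true → ∃ λ u → ι u ≡ v
    adj-es : ∀ u v → adj G u v ≡ es S (ι u) (ι v)

asGraph-realizes : (S : Subgraph (Q n)) → asGraph S Realizes S
asGraph-realizes S = record
  { ι = proj₁
  ; ι-injective = vs-irrelevant S
  ; ι-vs = proj₂
  ; lift = λ v p → (v , p) , refl
  ; adj-es = λ _ _ → refl }

full : ∀ n → Subgraph (Q n)
full n = record
  { vs = λ _ → true ; es = adj (Q n) ; es-sym = Q-sym ; es-adj = λ _ _ e → e ; es-vs = λ _ _ _ → refl }

Q-realizes-full : ∀ n → Q n Realizes full n
Q-realizes-full n = record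
  { ι = id ; ι-injective = id ; ι-vs = λ _ → refl ; lift = λ v _ → v , refl ; adj-es = λ _ _ → refl }

module _ {G : Graph} {S : Subgraph (Q n)} (G-realizes-S : G Realizes S) where
  open _Realizes_ G-realizes-S

  private
    inclusion : G ↪ Q n
    inclusion = record
      { at = ι
      ; injective = ι-injective
      ; homo = λ {u} {v} e → es-adj S (ι u) (ι v) (trans (sym (adj-es u v)) e) }

    _≟ᴳ_ : DecidableEquality (V G)
    u ≟ᴳ v = map′ ι-injective (cong ι) (ι u ≟ᵛ ι v)

    Copy : ℕ → Set
    Copy ℓ = Σ (Subgraph G) (λ X → asGraph X ≅ Q ℓ)

    -- The edges are all those of `Q n` between vertices of the cube, so a copy is determined by its
    -- cube; this rests on `reflect`.
    record _Describes_ (c : Cube n ℓ) (X : Copy ℓ) : Set where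
      field
        vs⇒ : ∀ u → vs (proj₁ X) u ≡ true → ι u ∈ᶜ c
        vs⇐ : ∀ u → ι u ∈ᶜ c → vs (proj₁ X) u ≡ true
        es⇒ : ∀ u v → es (proj₁ X) u v ≡ true → ι u ∈ᶜ c × ι v ∈ᶜ c × ι u ~ ι v
        es⇐ : ∀ u v → ι u ∈ᶜ c × ι v ∈ᶜ c × ι u ~ ι v → es (proj₁ X) u v ≡ true

    image-describes : {f : Q ℓ ↪ G} (im : HasCubeImage (inclusion ∘↪ f)) {X : Copy ℓ} →
      IsCopyOf f (proj₁ X) → HasCubeImage.cube im Describes X
    image-describes {f = f} im {X} copy = record
      { vs⇒ = λ u e → let (t , eq) = vs⇒ e in subst (_∈ᶜ cube) (cong ι eq) (into t)
      ; vs⇐ = λ u u∈ → let (t , eq) = onto u∈ in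
          subst (λ u → vs (proj₁ X) u ≡ true) (ι-injective eq) (vs⇐ t)
      ; es⇒ = λ u v e → let (s , t , st , p , q) = es⇒ e in
          subst (_∈ᶜ cube) (cong ι p) (into s) , subst (_∈ᶜ cube) (cong ι q) (into t) ,
          subst₂ (λ u v → ι u ~ ι v) p q (homo (inclusion ∘↪ f) st)
      ; es⇐ = λ u v (u∈ , v∈ , e) → let (s , p) = onto u∈ ; (t , q) = onto v∈ in
          subst₂ (λ u v → es (proj₁ X) u v ≡ true) (ι-injective p) (ι-injective q)
            (es⇐ (reflect (subst₂ _~_ (sym p) (sym q) e))) }
      where
      open HasCubeImage im
      open IsCopyOf copy

    build : {c : Cube n ℓ} → c ∈ cubesIn S ℓ → Σ (Copy ℓ) (c Describes_)
    build {ℓ} {c} c∈ = X ,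
      image-describes {f = f} image (embedding⇒copy-isCopy (vertices ℓ) ∈-vertices _≟ᴳ_ Q-sym f)
      where
      inside = proj₂ (∈-filter⁻ (inside? S) {xs = cubes n ℓ} c∈)
      ι-at : ∀ t → ι (proj₁ (lift (fill c t) (proj₁ inside t))) ≡ fill c t
      ι-at t = proj₂ (lift (fill c t) (proj₁ inside t))
      f : Q ℓ ↪ G
      f = record
        { at = λ t → proj₁ (lift (fill c t) (proj₁ inside t))
        ; injective = λ eq → fill-injective c (trans (sym (ι-at _)) (trans (cong ι eq) (ι-at _)))
        ; homo = λ {s} {t} e → trans (adj-es _ _)
            (trans (cong₂ (es S) (ι-at s) (ι-at t)) (proj₂ inside s t e)) }
      image : HasCubeImage (inclusion ∘↪ f)
      image = record
        { cube = c
        ; into = λ t → subst (_∈ᶜ c) (sym (ι-at t)) (fill-∈ c t)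
        ; onto = λ u∈ → let (t , eq) = ∈⇒fill u∈ in t , trans (ι-at t) eq
        ; reflect = λ {s} {t} e → trans (sym (fill-adj c s t)) (subst₂ _~_ (ι-at s) (ι-at t) e) }
      X = embedding⇒copy (vertices ℓ) ∈-vertices _≟ᴳ_ Q-sym f

    code : (X : Copy ℓ) → ∃ λ c → c ∈ cubesIn S ℓ × c Describes X
    code {ℓ} X = cube , ∈-filter⁺ (inside? S) (∈-cubes cube) (in-vs , in-es) , image-describes {f = f} im copy
      where
      f = proj₁ (copy⇒embedding X)
      copy = proj₂ (copy⇒embedding X)
      im = cube-image ℓ (inclusion ∘↪ f)
      open HasCubeImage im
      in-vs : ∀ t → vs S (fill cube t) ≡ true
      in-vs t = let (s , eq) = onto (fill-∈ cube t) in subst (λ u → vs S u ≡ true) eq (ι-vs _)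
      in-es : ∀ s t → s ~ t → es S (fill cube s) (fill cube t) ≡ true
      -- An edge of the cube is pulled back to `Q ℓ` by `reflect` and pushed into `G` by `f`, hence
      -- it belongs to `S`.
      in-es s t s~t =
        let (s′ , p) = onto (fill-∈ cube s)
            (t′ , q) = onto (fill-∈ cube t)
        in subst₂ (λ u v → es S u v ≡ true) p q (trans (sym (adj-es _ _)) (homo f
          (reflect (subst₂ _~_ (sym p) (sym q) (trans (fill-adj cube s t) s~t)))))

    same-copy : {c : Cube n ℓ} {X Y : Copy ℓ} → c Describes X → c Describes Y →
      (∀ v → vs (proj₁ X) v ≡ vs (proj₁ Y) v) × (∀ u v → es (proj₁ X) u v ≡ es (proj₁ Y) u v)
    same-copy cX cY =
      (λ v → bool-ext (Y.vs⇐ v ∘ X.vs⇒ v) (X.vs⇐ v ∘ Y.vs⇒ v)) ,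
      (λ u v → bool-ext (Y.es⇐ u v ∘ X.es⇒ u v) (X.es⇐ u v ∘ Y.es⇒ u v))
      where
      module X = _Describes_ cX
      module Y = _Describes_ cY

    covers : {c c′ : Cube n ℓ} {X Y : Copy ℓ} → c ∈ cubesIn S ℓ →
      (∀ v → vs (proj₁ X) v ≡ true → vs (proj₁ Y) v ≡ true) → c Describes X → c′ Describes Y →
      ∀ {u} → u ∈ᶜ c → u ∈ᶜ c′
    covers {ℓ} {c} {c′} c∈ X⊆Y cX c′Y u∈ with ∈⇒fill u∈
    ... | t , refl with lift (fill c t) (proj₁ (proj₂ (∈-filter⁻ (inside? S) {xs = cubes n ℓ} c∈)) t)
    ...   | v , eq = subst (_∈ᶜ c′) eq
              (_Describes_.vs⇒ c′Y v (X⊆Y v (_Describes_.vs⇐ cX v (subst (_∈ᶜ c) (sym eq) u∈))))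

  count-copies : ∀ ℓ → HasCount G (Q ℓ) (length (cubesIn S ℓ))
  count-copies ℓ = enumerate {L = cubesIn S ℓ} _Describes_
    (Unique.filter⁺ (inside? S) (cubes-unique n ℓ))
    build code same-copy
    λ {c} {c′} c∈ c′∈ (vs≈ , _) cX c′Y → cube-ext c c′
      (covers c∈ (λ v e → trans (sym (vs≈ v)) e) cX c′Y)
      (covers c′∈ (λ v e → trans (vs≈ v) e) c′Y cX)

HasCount-unique : {G T : Graph} {a b : ℕ} → HasCount G T a → HasCount G T b → a ≡ b
HasCount-unique f g = ↔⇒≡ (inverse f (inverse-sym g))

-- Extremal subgraphs

branch : (Vertex n → A) → (Vertex n → A) → Vertex (suc n) → A
branch f g (true ∷ v) = f v
branch f g (false ∷ v) = g v

functions : ∀ n → List A → List (Vertex n → A)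
functions zero xs = map (λ x _ → x) xs
functions (suc n) xs = cartesianProductWith branch (functions n xs) (functions n xs)

-- A relation `_R_` takes the place of equality so that the lemma can be applied to itself: an edge
-- table is a function into functions, and those are matched only pointwise.
functions-complete : ∀ n {xs : List A} (_R_ : B → A → Set) → (∀ b → ∃ λ a → a ∈ xs × b R a) →
  (f : Vertex n → B) → ∃ λ g → g ∈ functions n xs × (∀ v → f v R g v)
functions-complete zero _R_ rep f = let (a , a∈ , r) = rep (f []) in
  (λ _ → a) , ∈-map⁺ _ a∈ , λ { [] → r }
functions-complete (suc n) _R_ rep f =
  let (g , g∈ , r) = functions-complete n _R_ rep (f ∘ (true ∷_))
      (h , h∈ , s) = functions-complete n _R_ rep (f ∘ (false ∷_))
  in branch g h , ∈-cartesianProductWith⁺ branch g∈ h∈ , λ { (true ∷ v) → r v ; (false ∷ v) → s v }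

tuples : ∀ m → List A → List (Fin m → A)
tuples zero xs = F.[] ∷ []
tuples (suc m) xs = cartesianProductWith F._∷_ xs (tuples m xs)

tuples-complete : ∀ m {xs : List A} → (∀ a → a ∈ xs) → (f : Fin m → A) →
  ∃ λ g → g ∈ tuples m xs × f ≗ g
tuples-complete zero _ f = F.[] , here refl , λ ()
tuples-complete (suc m) all∈ f = let (g , g∈ , r) = tuples-complete m all∈ (f ∘ suc) in
  f zero F.∷ g , ∈-cartesianProductWith⁺ F._∷_ (all∈ (f zero)) g∈ , λ { zero → refl ; (suc i) → r i }

infix 4 _≈ˢ_
_≈ˢ_ : Subgraph (Q n) → Subgraph (Q n) → Set
S ≈ˢ S′ = (∀ v → vs S v ≡ vs S′ v) × (∀ u v → es S u v ≡ es S′ u v)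

∧-true : ∀ {b c} → b ∧ c ≡ true → b ≡ true × c ≡ true
∧-true {true} {true} _ = refl , refl

-- Turns arbitrary Boolean tables into a subgraph by imposing the axioms. The tables of an actual
-- subgraph pass through unchanged, so every subgraph is reached.
trim : (Vertex n → Bool) → (Vertex n → Vertex n → Bool) → Subgraph (Q n)
trim p q = record
  { vs = p
  ; es = λ u v → (adj (Q _) u v ∧ p u ∧ q u v) ∧ (adj (Q _) v u ∧ p v ∧ q v u)
  ; es-sym = λ u v → Bool.∧-comm (adj (Q _) u v ∧ p u ∧ q u v) _
  ; es-adj = λ u v e → proj₁ (∧-true {adj (Q _) u v} (proj₁ (∧-true e)))
  ; es-vs = λ u v e → proj₁ (∧-true {p u} (proj₂ (∧-true {adj (Q _) u v} (proj₁ (∧-true e))))) }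

subgraphs : ∀ n → List (Subgraph (Q n))
subgraphs n = cartesianProductWith trim (functions n bools) (functions n (functions n bools))
  where bools = true ∷ false ∷ []

subgraphs-complete : (S : Subgraph (Q n)) → ∃ λ S′ → S′ ∈ subgraphs n × S ≈ˢ S′
subgraphs-complete {n} S =
  let (p , p∈ , p≈) = functions-complete n _≡_ bool (vs S)
      (q , q∈ , q≈) = functions-complete n (λ f g → ∀ v → f v ≡ g v) (functions-complete n _≡_ bool) (es S)
  in trim p q , ∈-cartesianProductWith⁺ trim p∈ q∈ , p≈ , λ u v → bool-ext
    (λ e → cong₂ _∧_ (half p≈ q≈ u v e) (half p≈ q≈ v u (trans (es-sym S v u) e)))
    (λ e → trans (q≈ u v) (proj₂ (∧-true {p u} (proj₂ (∧-true {adj (Q _) u v} (proj₁ (∧-true e)))))))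
  where
  bool : ∀ b → ∃ λ a → a ∈ (true ∷ false ∷ []) × b ≡ a
  bool true = true , here refl , refl
  bool false = false , there (here refl) , refl
  half : {p : Vertex n → Bool} {q : Vertex n → Vertex n → Bool} →
    (∀ v → vs S v ≡ p v) → (∀ u v → es S u v ≡ q u v) → ∀ u v → es S u v ≡ true →
    adj (Q n) u v ∧ p u ∧ q u v ≡ true
  half p≈ q≈ u v e = cong₂ _∧_ (es-adj S u v e)
    (cong₂ _∧_ (trans (sym (p≈ u)) (es-vs S u v e)) (trans (sym (q≈ u v)) e))

record IsCycle (S : Subgraph (Q n)) (m : ℕ) (h : Fin m → Vertex n) : Set where
  constructor isCycle
  field
    cycle-injective : ∀ i j → h i ≡ h j → i ≡ j
    cycle-vs : ∀ i → vs S (h i) ≡ true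
    cycle-es : ∀ i j → adj (Cyc m) i j ≡ true → es S (h i) (h j) ≡ true

HasCycle : Subgraph (Q n) → ℕ → Set
HasCycle S m = ∃ (IsCycle S m)

cycle-resp : {S S′ : Subgraph (Q n)} → S ≈ˢ S′ → HasCycle S m → HasCycle S′ m
cycle-resp (vs≈ , es≈) (h , isCycle inj hvs hes) = h , isCycle inj
  (λ i → trans (sym (vs≈ (h i))) (hvs i))
  (λ i j e → trans (sym (es≈ (h i) (h j))) (hes i j e))

hasCycle? : (S : Subgraph (Q n)) (m : ℕ) → Dec (HasCycle S m)
hasCycle? {n} S m = map′ Any.satisfied complete (any? isCycle? (tuples m (vertices n)))
  where
  isCycle? : ∀ h → Dec (IsCycle S m h)
  isCycle? h = map′ (λ (a , b , c) → isCycle a b c) (λ (isCycle a b c) → a , b , c)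
    ( Fin.all? (λ i → Fin.all? λ j → (h i ≟ᵛ h j) →-dec (i Fin.≟ j))
    ×-dec Fin.all? (λ i → vs S (h i) Bool.≟ true)
    ×-dec Fin.all? (λ i → Fin.all? λ j → (adj (Cyc m) i j Bool.≟ true) →-dec (es S (h i) (h j) Bool.≟ true)))
  complete : HasCycle S m → Any (IsCycle S m) (tuples m (vertices n))
  complete (h , isCycle inj hvs hes) = let (g , g∈ , h≗g) = tuples-complete m ∈-vertices h in
    lose g∈ (isCycle
      (λ i j e → inj i j (trans (h≗g i) (trans e (sym (h≗g j)))))
      (λ i → trans (cong (vs S) (sym (h≗g i))) (hvs i))
      (λ i j e → trans (cong₂ (es S) (sym (h≗g i)) (sym (h≗g j))) (hes i j e)))

Cyc-sym : ∀ m (i j : Fin m) → adj (Cyc m) i j ≡ adj (Cyc m) j i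
Cyc-sym m i j = swap (suc (toℕ i) ≡ᵇ toℕ j) (suc (toℕ j) ≡ᵇ toℕ i)
  ((toℕ i ≡ᵇ 0) ∧ (suc (toℕ j) ≡ᵇ m)) ((toℕ j ≡ᵇ 0) ∧ (suc (toℕ i) ≡ᵇ m))
  where
  swap : ∀ a b c d → a ∨ b ∨ c ∨ d ≡ b ∨ a ∨ d ∨ c
  swap true true c d = refl
  swap true false c d = refl
  swap false true c d = refl
  swap false false c d = Bool.∨-comm c d

module _ {S : Subgraph (Q n)} where

  ¬cycle⇒free : ¬ HasCycle S m → Free (asGraph S) (Cyc m)
  ¬cycle⇒free ¬cycle X = let (f , _) = copy⇒embedding X in
    ¬cycle (proj₁ ∘ at f , isCycle
      (λ i j eq → injective f (vs-irrelevant S eq)) (proj₂ ∘ at f) (λ i j → homo f))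

  free⇒¬cycle : Free (asGraph S) (Cyc m) → ¬ HasCycle S m
  free⇒¬cycle {m} free (h , isCycle inj hvs hes) = free
    (embedding⇒copy (allFin m) ∈-allFin
      (λ u v → map′ (vs-irrelevant S) (cong proj₁) (proj₁ u ≟ᵛ proj₁ v)) (Cyc-sym m)
      record { at = λ i → h i , hvs i ; injective = λ eq → inj _ _ (cong proj₁ eq) ; homo = hes _ _ })

count-mono : {S S′ : Subgraph (Q n)} → (∀ {c : Cube n ℓ} → Inside S c → Inside S′ c) →
  length (cubesIn S ℓ) ≤ length (cubesIn S′ ℓ)
count-mono {n} {ℓ} {S} {S′} f = unique⇒length≤ (Unique.filter⁺ (inside? S) (cubes-unique n ℓ))
  λ c∈ → let (∈all , inside) = ∈-filter⁻ (inside? S) {xs = cubes n ℓ} c∈ in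
    ∈-filter⁺ (inside? S′) ∈all (f inside)

edgeless : ∀ n → Subgraph (Q n)
edgeless n = record { vs = λ _ → false ; es = λ _ _ → false ; es-sym = λ _ _ → refl
                    ; es-adj = λ _ _ () ; es-vs = λ _ _ () }

maximiser : {P : A → Set} (f : A → ℕ) → (∀ a → Dec (P a)) → ∃ P → (xs : List A) →
  ∃ λ a → P a × (∀ {x} → x ∈ xs → P x → f x ≤ f a)
maximiser f P? (a₀ , p₀) xs = argmax f a₀ (filter P? xs)
  , argmax-all f p₀ (All.all-filter P? xs)
  , λ x∈ px → All.lookup (f[xs]≤f[argmax] a₀ (filter P? xs)) (∈-filter⁺ P? x∈ px)

extremal : ∀ n ℓ m → ∃ λ (S : Subgraph (Q n)) → ¬ HasCycle S (suc m) ×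
  (∀ S′ → ¬ HasCycle S′ (suc m) → length (cubesIn S′ ℓ) ≤ length (cubesIn S ℓ))
extremal n ℓ m =
  let (S , free , max) = maximiser (λ S → length (cubesIn S ℓ)) (λ S → ¬? (hasCycle? S (suc m)))
        -- The search starts from the subgraph without vertices; a cycle of length `suc m` would
        -- have a vertex `zero` in it.
        (edgeless n , λ (h , c) → contradiction (IsCycle.cycle-vs c zero) λ ()) (subgraphs n)
  in S , free , λ S₁ ¬cycle →
    let (S′ , S′∈ , vs≈ , es≈) = subgraphs-complete S₁ in
    ℕ.≤-trans
      (count-mono {S = S₁} {S′} λ (a , b) →
        (λ t → trans (sym (vs≈ _)) (a t)) , (λ s t e → trans (sym (es≈ _ _)) (b s t e)))
      (max S′∈ (¬cycle ∘ cycle-resp {S = S′} {S₁} ((λ v → sym (vs≈ v)) , (λ u v → sym (es≈ u v)))))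

isEx : (S : Subgraph (Q n)) → ¬ HasCycle S m →
  (∀ S′ → ¬ HasCycle S′ m → length (cubesIn S′ ℓ) ≤ length (cubesIn S ℓ)) →
  IsEx (Q n) (Q ℓ) (Cyc m) (length (cubesIn S ℓ))
isEx {ℓ = ℓ} S free max = (S , ¬cycle⇒free free , count-copies (asGraph-realizes S) ℓ)
  , λ S′ a free′ copies → subst (_≤ length (cubesIn S ℓ))
      (HasCount-unique (count-copies (asGraph-realizes S′) ℓ) copies)
      (max S′ (free⇒¬cycle free′))

-- Even cycles in cubes

data Path {A : Set} (E : A → A → Set) : A → A → List A → Set where
  [_] : ∀ u → Path E u u (u ∷ [])
  _∷_ : ∀ {u v w xs} → E u w → Path E w v xs → Path E u v (u ∷ xs)

module _ {E : A → A → Set} where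

  path-first : ∀ {u v xs} → Path E u v xs → ∀ i → toℕ i ≡ 0 → lookup xs i ≡ u
  path-first [ u ] zero _ = refl
  path-first (_ ∷ _) zero _ = refl

  path-last : ∀ {u v xs} → Path E u v xs → ∀ i → suc (toℕ i) ≡ length xs → lookup xs i ≡ v
  path-last [ u ] zero _ = refl
  path-last (_ ∷ [ v ]) zero ()
  path-last (_ ∷ (_ ∷ _)) zero ()
  path-last (_ ∷ p) (suc i) eq = path-last p i (ℕ.suc-injective eq)

  path-step : ∀ {u v xs} → Path E u v xs → ∀ i j → suc (toℕ i) ≡ toℕ j → E (lookup xs i) (lookup xs j)
  path-step [ u ] zero zero ()
  path-step (e ∷ p) zero (suc j) eq = subst (E _) (sym (path-first p j (sym (ℕ.suc-injective eq)))) e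
  path-step (e ∷ p) (suc i) (suc j) eq = path-step p i j (ℕ.suc-injective eq)

  path-snoc : ∀ {u v w xs} → Path E u v xs → E v w → Path E u w (xs ++ w ∷ [])
  path-snoc [ u ] e = e ∷ [ _ ]
  path-snoc (e′ ∷ p) e = e′ ∷ path-snoc p e

  path-take : ∀ {u v xs} k → Path E u v xs → ∃ λ w → Path E u w (take (suc k) xs)
  path-take k [ u ] = u , subst (λ xs → Path E u u (u ∷ xs)) (sym (take-[] k)) [ u ]
  path-take zero (e ∷ p) = _ , [ _ ]
  path-take (suc k) (e ∷ p) = let (w , q) = path-take k p in w , e ∷ q

∨-true : ∀ {b c} → b ∨ c ≡ true → b ≡ true ⊎ c ≡ true
∨-true {true} _ = inj₁ refl
∨-true {false} e = inj₂ e

≡ᵇ-true : ∀ a b → (a ≡ᵇ b) ≡ true → a ≡ b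
≡ᵇ-true a b e = ℕ.≡ᵇ⇒≡ a b (subst T (sym e) tt)

module _ (S : Subgraph (Q n)) where

  Edge : Vertex n → Vertex n → Set
  Edge u v = es S u v ≡ true

  edge-sym : ∀ {u v} → Edge u v → Edge v u
  edge-sym e = trans (es-sym S _ _) e

  path-vs : ∀ {u v xs} → Path Edge u v xs → vs S v ≡ true → ∀ i → vs S (lookup xs i) ≡ true
  path-vs [ u ] v∈ zero = v∈
  path-vs (e ∷ p) v∈ zero = es-vs S _ _ e
  path-vs (e ∷ p) v∈ (suc i) = path-vs p v∈ i

  -- Adjacency in `Cyc` has four disjuncts: a step of the path in either direction, and the closing
  -- edge in either direction.
  closed-path⇒cycle : ∀ {u v xs} → Path Edge u v xs → Edge v u → Unique xs → HasCycle S (length xs)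
  closed-path⇒cycle {u} {v} {xs} p vu xs! = lookup xs , isCycle (lookup-injective xs!)
    (path-vs p (es-vs S _ _ vu)) edge
    where
    edge : ∀ i j → adj (Cyc (length xs)) i j ≡ true → Edge (lookup xs i) (lookup xs j)
    edge i j e with ∨-true {suc (toℕ i) ≡ᵇ toℕ j} e
    ... | inj₁ e₁ = path-step p i j (≡ᵇ-true _ (toℕ j) e₁)
    ... | inj₂ e′ with ∨-true {suc (toℕ j) ≡ᵇ toℕ i} e′
    ...   | inj₁ e₂ = edge-sym (path-step p j i (≡ᵇ-true _ (toℕ i) e₂))
    ...   | inj₂ e″ with ∨-true {(toℕ i ≡ᵇ 0) ∧ (suc (toℕ j) ≡ᵇ length xs)} e″
    ...     | inj₁ e₃ = let (p₁ , p₂) = ∧-true {toℕ i ≡ᵇ 0} e₃ in subst₂ Edge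
                (sym (path-first p i (≡ᵇ-true _ 0 p₁)))
                (sym (path-last p j (≡ᵇ-true _ (length xs) p₂)))
                (edge-sym vu)
    ...     | inj₂ e₄ = let (p₁ , p₂) = ∧-true {toℕ j ≡ᵇ 0} e₄ in subst₂ Edge
                (sym (path-last p i (≡ᵇ-true _ (length xs) p₂)))
                (sym (path-first p j (≡ᵇ-true _ 0 p₁)))
                vu

-- Walks along the path in the face `false` and back along it in the face `true`. The two ends
-- differ only in the first coordinate, so the walk closes up to a cycle.
ladder : List (Vertex n) → List (Vertex (suc n))
ladder [] = []
ladder (p ∷ ps) = (false ∷ p) ∷ ladder ps ++ (true ∷ p) ∷ []

ladder-path : ∀ {u v : Vertex n} {ps} → Path _~_ u v ps → Path _~_ (false ∷ u) (true ∷ u) (ladder ps)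
ladder-path [ u ] = not~ false u ∷ [ true ∷ u ]
ladder-path {u = u} (_∷_ {w = w} e p) =
  ∷~ false u w e ∷ path-snoc (ladder-path p) (trans (Q-sym (true ∷ w) (true ∷ u)) (∷~ true u w e))

∈-ladder : ∀ (ps : List (Vertex n)) {b p} → (b ∷ p) ∈ ladder ps → p ∈ ps
∈-ladder (q ∷ ps) (here eq) = here (Vec.∷-injectiveʳ eq)
∈-ladder (q ∷ ps) (there p∈) with ∈-++⁻ (ladder ps) p∈
... | inj₁ p∈ps = there (∈-ladder ps p∈ps)
... | inj₂ (here eq) = here (Vec.∷-injectiveʳ eq)

ladder-unique : {ps : List (Vertex n)} → Unique ps → Unique (ladder ps)
ladder-unique [] = []
ladder-unique {ps = p ∷ ps} (p∉ ∷ ps!) =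
  All.tabulate (λ q∈ eq → fresh q∈ (sym eq)) ∷
  Unique.++⁺ (ladder-unique ps!) ([] ∷ []) λ { (q∈ , here refl) → All.lookup p∉ (∈-ladder ps q∈) refl }
  where
  fresh : ∀ {q} → q ∈ ladder ps ++ (true ∷ p) ∷ [] → q ≢ false ∷ p
  fresh q∈ refl with ∈-++⁻ (ladder ps) q∈
  ... | inj₁ q∈ps = All.lookup p∉ (∈-ladder ps q∈ps) refl
  ... | inj₂ (here ())

length-ladder : (ps : List (Vertex n)) → length (ladder ps) ≡ 2 * length ps
length-ladder [] = refl
length-ladder (p ∷ ps) = cong suc (begin
  length (ladder ps ++ (true ∷ p) ∷ []) ≡⟨ length-++ (ladder ps) ⟩
  length (ladder ps) + 1 ≡⟨ ℕ.+-comm _ 1 ⟩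
  suc (length (ladder ps)) ≡⟨ cong suc (length-ladder ps) ⟩
  suc (2 * length ps) ≡⟨ ℕ.+-suc (length ps) _ ⟨
  length ps + suc (length ps + 0) ∎)
  where open ≡-Reasoning

-- The reflected Gray code.
hamiltonian : ∀ ℓ → ∃₂ λ (u v : Vertex ℓ) → ∃ λ ps → Path _~_ u v ps × Unique ps × length ps ≡ 2 ^ ℓ
hamiltonian zero = [] , [] , [] ∷ [] , [ [] ] , [] ∷ [] , refl
hamiltonian (suc ℓ) = let (u , v , ps , path , ps! , len) = hamiltonian ℓ in
  false ∷ u , true ∷ u , ladder ps , ladder-path path , ladder-unique ps! ,
  trans (length-ladder ps) (cong (2 *_) len)

-- The ladder over the first `k` vertices of a Hamiltonian path one dimension lower is a cycle of
-- length `2 * k`.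
even-cycle : ∀ {ℓ k} → 1 ≤ k → 2 * k ≤ 2 ^ ℓ → HasCycle (full ℓ) (2 * k)
even-cycle {zero} {suc k} _ le = contradiction (subst (_≤ 1) (ℕ.*-comm 2 (suc k)) le) λ { (s≤s ()) }
even-cycle {suc ℓ} {suc k} _ le =
  let (u , v , ps , path , ps! , len) = hamiltonian ℓ
      (w , path′) = path-take k path
      k≤ = ℕ.*-cancelˡ-≤ 2 le
  in subst (HasCycle (full (suc ℓ)))
    (trans (length-ladder (take (suc k) ps)) (cong (2 *_)
      (trans (length-take (suc k) ps) (ℕ.m≤n⇒m⊓n≡m (subst (suc k ≤_) (sym len) k≤)))))
    (closed-path⇒cycle (full (suc ℓ)) (ladder-path path′)
      (trans (Q-sym (true ∷ u) (false ∷ u)) (not~ false u))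
      (ladder-unique (Unique.take⁺ (suc k) ps!)))

cycle-inside : {S : Subgraph (Q n)} {c : Cube n ℓ} → Inside S c → HasCycle (full ℓ) m → HasCycle S m
cycle-inside {c = c} (in-vs , in-es) (h , isCycle inj _ hes) = fill c ∘ h , isCycle
  (λ i j eq → inj i j (fill-injective c eq)) (in-vs ∘ h) (λ i j e → in-es (h i) (h j) (hes i j e))

-- Cubes through a fixed vertex

module _ (S : Subgraph (Q n)) (x : Vertex n) where

  -- The rims are oriented along the walk from `toggle i x` to `toggle j x` around the corner
  -- opposite to `x`.
  record Linked (i j : Fin n) : Set where
    constructor linked
    field
      distinct : i ≢ j
      spokeˡ : Edge S x (toggle i x)
      spokeʳ : Edge S x (toggle j x)
      rimˡ : Edge S (toggle i x) (toggle j (toggle i x))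
      rimʳ : Edge S (toggle j (toggle i x)) (toggle j x)

  linked? : ∀ i j → Dec (Linked i j)
  linked? i j = map′ (λ (a , b , c , d , e) → linked a b c d e) (λ (linked a b c d e) → a , b , c , d , e)
    (¬? (i Fin.≟ j) ×-dec (_ Bool.≟ true) ×-dec (_ Bool.≟ true) ×-dec (_ Bool.≟ true) ×-dec (_ Bool.≟ true))

  zigzag : List (Fin n) → List (Vertex n)
  zigzag [] = []
  zigzag (i ∷ []) = toggle i x ∷ []
  zigzag (i ∷ j ∷ js) = toggle i x ∷ toggle j (toggle i x) ∷ zigzag (j ∷ js)

  zigzag-path : ∀ {i j is} → Path Linked i j is → Path (Edge S) (toggle i x) (toggle j x) (zigzag is)
  zigzag-path [ i ] = [ _ ]
  -- The two cases differ only in exposing the head of the remaining list, on which `zigzag`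
  -- computes.
  zigzag-path (r ∷ p@([ _ ])) = Linked.rimˡ r ∷ Linked.rimʳ r ∷ zigzag-path p
  zigzag-path (r ∷ p@(_ ∷ _)) = Linked.rimˡ r ∷ Linked.rimʳ r ∷ zigzag-path p

  last-spoke : ∀ {i j is} → Path Linked i j is → Edge S x (toggle i x) → Edge S x (toggle j x)
  last-spoke [ _ ] e = e
  last-spoke (r ∷ p) _ = last-spoke p (Linked.spokeʳ r)

  -- The extra `suc` is the base vertex `x`, through which the zigzag is closed.
  length-zigzag : ∀ i is → suc (length (zigzag (i ∷ is))) ≡ 2 * length (i ∷ is)
  length-zigzag i [] = refl
  length-zigzag i (j ∷ js) = trans (cong (2 +_) (length-zigzag j js)) (sym (ℕ.*-suc 2 (length (j ∷ js))))

  zigzag-off : ∀ {i is} → All (i ≢_) is → All (λ u → Vec.lookup u i ≡ Vec.lookup x i) (zigzag is)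
  zigzag-off [] = []
  zigzag-off (i≢ ∷ []) = toggle-off i≢ x ∷ []
  zigzag-off {is = j ∷ _} (i≢j ∷ i≢@(i≢k ∷ _)) =
    toggle-off i≢j x ∷ trans (toggle-off i≢k (toggle j x)) (toggle-off i≢j x) ∷ zigzag-off i≢

  differ : ∀ {i : Fin n} {u v : Vertex n} {b} → Vec.lookup u i ≡ not b → Vec.lookup v i ≡ b → u ≢ v
  differ p q refl = Bool.not-¬ q p

  toggle²-at : ∀ {i j} → i ≢ j → Vec.lookup (toggle j (toggle i x)) i ≡ not (Vec.lookup x i)
  toggle²-at {i} i≢j = trans (toggle-off i≢j (toggle i x)) (toggle-at _ x)

  zigzag-avoids-base : ∀ {is} → Unique is → All (x ≢_) (zigzag is)
  zigzag-avoids-base [] = []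
  zigzag-avoids-base ([] ∷ []) = (toggle≢ _ x ∘ sym) ∷ []
  zigzag-avoids-base ((i≢j ∷ _) ∷ is!@(_ ∷ _)) =
    (toggle≢ _ x ∘ sym) ∷ (λ eq → differ (toggle²-at i≢j) refl (sym eq)) ∷ zigzag-avoids-base is!

  -- The two vertices starting a zigzag differ from the rest in the first direction.
  zigzag-unique : ∀ {is} → Unique is → Unique (zigzag is)
  zigzag-unique [] = []
  zigzag-unique ([] ∷ []) = [] ∷ []
  zigzag-unique (i≢@(i≢j ∷ _) ∷ is!@(_ ∷ _)) =
    ((toggle≢ _ _ ∘ sym) ∷ All.map (differ (toggle-at _ x)) (zigzag-off i≢))
    ∷ All.map (differ (toggle²-at i≢j)) (zigzag-off i≢)
    ∷ zigzag-unique is!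

  linked-path⇒cycle : ∀ {i j is p} → Path Linked i j is → Unique is → length is ≡ suc (suc p) →
    HasCycle S (2 * suc (suc p))
  linked-path⇒cycle path@(_∷_ {u = i} {xs = is} r _) is! len =
    subst (HasCycle S) (trans (length-zigzag i is) (cong (2 *_) len))
      (closed-path⇒cycle S (Linked.spokeˡ r ∷ zigzag-path path)
        (edge-sym S (last-spoke path (Linked.spokeˡ r)))
        (zigzag-avoids-base is! ∷ zigzag-unique is!))

-- Cliques in a graph without long paths

module _ {n : ℕ} {R : Fin n → Fin n → Set} (R? : ∀ i j → Dec (R i j)) (p : ℕ)
  (short : ∀ {i j is} → Path R i j is → Unique is → length is ≢ suc p) where

  -- A path inside `W` is prolonged greedily at its head. The fuel `f` is the number of vertices
  -- missing to the forbidden length `suc p`, so it cannot run out; once the path is stuck, every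
  -- neighbour of its head in `W` already lies on it.
  saturated : (W : List (Fin n)) → ∀ f {i j is} → Path R i j is → Unique is → All (_∈ W) is →
    length is + f ≡ suc p →
    ∃₂ λ h hs → h ∈ W × h ∈ hs × length hs ≤ p × (∀ {w} → w ∈ W → R w h → w ∈ hs)
  saturated W zero path is! is⊆W len = contradiction (trans (sym (ℕ.+-identityʳ _)) len) (short path is!)
  saturated W (suc f) {i} {j} {is} path is! is⊆W len
    with any? (λ w → R? w i ×-dec ¬? (Any.any? (w Fin.≟_) is)) W
  ... | yes extension = let (w , w∈W , r , w∉is) = find extension in
    saturated W f (r ∷ path) (All.¬Any⇒All¬ is w∉is ∷ is!) (w∈W ∷ is⊆W)
      (trans (sym (ℕ.+-suc _ f)) len)
  ... | no maximal = i , is , All.lookup is⊆W (head∈ path) , head∈ path ,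
    ℕ.s≤s⁻¹ (subst (suc (length is) ≤_) (trans (sym (ℕ.+-suc _ f)) len) (ℕ.m≤m+n _ f)) ,
    closed
    where
    head∈ : ∀ {i j is} → Path R i j is → i ∈ is
    head∈ [ _ ] = here refl
    head∈ (_ ∷ _) = here refl
    closed : ∀ {w} → w ∈ W → R w i → w ∈ is
    closed {w} w∈W r with Any.any? (w Fin.≟_) is
    ... | yes w∈is = w∈is
    ... | no w∉is = contradiction (lose w∈W (r , w∉is)) maximal

  -- Sets are indicator vectors. Restricting one to the positions in `hs` loses nothing, as it is
  -- `false` elsewhere.
  subsets-of : {Ds : List (Vertex n)} (hs : List (Fin n)) → Unique Ds →
    (∀ {D i} → D ∈ Ds → Vec.lookup D i ≡ true → i ∈ hs) → length Ds ≤ 2 ^ length hs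
  subsets-of {Ds} hs Ds! ⊆hs = subst₂ _≤_ (length-map restrict Ds) (length-vertices (length hs))
    (unique⇒length≤ (map-unique restrict-injective Ds!) (λ _ → ∈-vertices _))
    where
    restrict : Vertex n → Vertex (length hs)
    restrict D = Vec.tabulate (λ k → Vec.lookup D (lookup hs k))
    transfer : ∀ {D D′} → D ∈ Ds → restrict D ≡ restrict D′ →
      ∀ i → Vec.lookup D i ≡ true → Vec.lookup D′ i ≡ true
    transfer {D} {D′} D∈ eq i e = let i∈ = ⊆hs D∈ e in begin
      Vec.lookup D′ i ≡⟨ cong (Vec.lookup D′) (Any.lookup-index i∈) ⟩
      Vec.lookup D′ (lookup hs (Any.index i∈)) ≡⟨ Vec.lookup∘tabulate _ (Any.index i∈) ⟨
      Vec.lookup (restrict D′) (Any.index i∈) ≡⟨ cong (λ v → Vec.lookup v (Any.index i∈)) eq ⟨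
      Vec.lookup (restrict D) (Any.index i∈) ≡⟨ Vec.lookup∘tabulate _ (Any.index i∈) ⟩
      Vec.lookup D (lookup hs (Any.index i∈)) ≡⟨ cong (Vec.lookup D) (Any.lookup-index i∈) ⟨
      Vec.lookup D i ≡⟨ e ⟩
      true ∎
      where open ≡-Reasoning
    restrict-injective : ∀ {D D′} → D ∈ Ds → D′ ∈ Ds → restrict D ≡ restrict D′ → D ≡ D′
    restrict-injective {D} {D′} D∈ D′∈ eq = begin
      D ≡⟨ Vec.tabulate∘lookup D ⟨
      Vec.tabulate (Vec.lookup D)
        ≡⟨ Vec.tabulate-cong (λ i → bool-ext (transfer {D} {D′} D∈ eq i) (transfer {D′} {D} D′∈ (sym eq) i)) ⟩
      Vec.tabulate (Vec.lookup D′) ≡⟨ Vec.tabulate∘lookup D′ ⟩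
      D′ ∎
      where open ≡-Reasoning

  -- `inhabited` excludes the empty set, so that nothing is left to count once `W` is empty.
  record Clique (W : List (Fin n)) (D : Vertex n) : Set where
    constructor clique
    field
      inhabited : ∃ λ i → Vec.lookup D i ≡ true
      within : ∀ {i} → Vec.lookup D i ≡ true → i ∈ W
      related : ∀ {i j} → Vec.lookup D i ≡ true → Vec.lookup D j ≡ true → i ≢ j → R i j

  -- The end h of a path that cannot be prolonged has all its neighbours on the path,
  -- so at most 2 ^ p cliques contain h, and h may then be discarded.
  clique-bound : ∀ b W {Ds} → length W ≤ b → Unique Ds → (∀ {D} → D ∈ Ds → Clique W D) →
    length Ds ≤ b * 2 ^ p
  clique-bound b W {[]} _ _ _ = z≤n
  clique-bound b [] {D ∷ Ds} _ _ cl with cl (here refl)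
  ... | clique (i , e) within _ with within e
  ...   | ()
  clique-bound (suc b) W@(w ∷ ws) {Ds@(_ ∷ _)} len Ds! cl with
    -- The one-vertex path at `w` leaves fuel `p`. The recursion runs on the bound `b`, because
    -- discarding `h` strictly shortens `W`.
    saturated W p [ w ] ([] ∷ []) (here refl ∷ []) refl
  ... | h , hs , h∈W , h∈hs , hs≤p , closed = begin
    length Ds ≡⟨ filter-complement contains? Ds ⟩
    length (filter contains? Ds) + length (filter (¬? ∘ contains?) Ds)
      ≤⟨ ℕ.+-mono-≤
          (ℕ.≤-trans (subsets-of hs (Unique.filter⁺ contains? Ds!) on-path) (ℕ.^-monoʳ-≤ 2 hs≤p))
          (clique-bound b (filter (¬? ∘ (Fin._≟ h)) W)
            (ℕ.s≤s⁻¹ (ℕ.≤-trans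
              (filter-notAll (¬? ∘ (Fin._≟ h)) W (Any.map (λ h≡x ¬p → ¬p (sym h≡x)) h∈W)) len))
            (Unique.filter⁺ (¬? ∘ contains?) Ds!) avoiding) ⟩
    2 ^ p + b * 2 ^ p ∎
    where
    open ℕ.≤-Reasoning
    contains? : ∀ D → Dec (Vec.lookup D h ≡ true)
    contains? D = Vec.lookup D h Bool.≟ true
    on-path : ∀ {D i} → D ∈ filter contains? Ds → Vec.lookup D i ≡ true → i ∈ hs
    on-path {D} {i} D∈ e with ∈-filter⁻ contains? {xs = Ds} D∈ | i Fin.≟ h
    ... | _ | yes refl = h∈hs
    ... | D∈Ds , h∈D | no i≢h =
      closed (Clique.within (cl D∈Ds) e) (Clique.related (cl D∈Ds) e h∈D i≢h)
    avoiding : ∀ {D} → D ∈ filter (¬? ∘ contains?) Ds → Clique (filter (¬? ∘ (Fin._≟ h)) W) D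
    avoiding {D} D∈ = let (D∈Ds , h∉D) = ∈-filter⁻ (¬? ∘ contains?) {xs = Ds} D∈ in clique
      (Clique.inhabited (cl D∈Ds))
      (λ {i} e → ∈-filter⁺ (¬? ∘ (Fin._≟ h)) (Clique.within (cl D∈Ds) e) (λ { refl → h∉D e }))
      (Clique.related (cl D∈Ds))

-- Averaging over the vertices

stars : Cube n ℓ → Vertex n
stars [] = []
stars (b ∷ c) = false ∷ stars c
stars (✶∷ c) = true ∷ stars c

star : (c : Cube n (suc ℓ)) → ∃ λ i → Vec.lookup (stars c) i ≡ true
star (b ∷ c) = let (i , e) = star c in suc i , e
star (✶∷ c) = zero , refl

toggle-star : {c : Cube n ℓ} {u : Vertex n} {i : Fin n} →
  Vec.lookup (stars c) i ≡ true → u ∈ᶜ c → toggle i u ∈ᶜ c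
toggle-star {i = suc i} e (b ∷ u∈) = b ∷ toggle-star e u∈
toggle-star {i = zero} e (✶∷ u∈) = ✶∷ u∈
toggle-star {i = suc i} e (✶∷ u∈) = ✶∷ toggle-star e u∈

stars-injective : {c c′ : Cube n ℓ} {u : Vertex n} → u ∈ᶜ c → u ∈ᶜ c′ → stars c ≡ stars c′ → c ≡ c′
stars-injective [] [] _ = refl
stars-injective (b ∷ u∈) (.b ∷ u∈′) eq = cong (b ∷_) (stars-injective u∈ u∈′ (Vec.∷-injectiveʳ eq))
stars-injective (✶∷ u∈) (✶∷ u∈′) eq = cong ✶∷_ (stars-injective u∈ u∈′ (Vec.∷-injectiveʳ eq))
stars-injective (b ∷ u∈) (✶∷ u∈′) eq = contradiction (Vec.∷-injectiveˡ eq) λ ()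
stars-injective (✶∷ u∈) (b ∷ u∈′) eq = contradiction (Vec.∷-injectiveˡ eq) λ ()

inside-edge : {S : Subgraph (Q n)} {c : Cube n ℓ} {u v : Vertex n} →
  Inside S c → u ∈ᶜ c → v ∈ᶜ c → u ~ v → Edge S u v
inside-edge {c = c} (_ , in-es) u∈ v∈ e with ∈⇒fill u∈ | ∈⇒fill v∈
... | s , refl | t , refl = in-es s t (trans (sym (fill-adj c s t)) e)

inside-linked : {S : Subgraph (Q n)} {c : Cube n ℓ} {x : Vertex n} {i j : Fin n} → Inside S c → x ∈ᶜ c →
  Vec.lookup (stars c) i ≡ true → Vec.lookup (stars c) j ≡ true → i ≢ j → Linked S x i j
inside-linked {S = S} {c} {x} {i} {j} inside x∈ ei ej i≢j = linked i≢j
  (edge x∈ xi (~-toggle i x))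
  (edge x∈ xj (~-toggle j x))
  (edge xi xij (~-toggle j (toggle i x)))
  (edge xij xj (trans (Q-sym (toggle j (toggle i x)) (toggle j x))
    (subst (toggle j x ~_) (Vec.updateAt-commutes i j i≢j x) (~-toggle i (toggle j x)))))
  where
  edge : ∀ {u v} → u ∈ᶜ c → v ∈ᶜ c → u ~ v → Edge S u v
  edge = inside-edge {S = S} {c} inside
  xi = toggle-star {c = c} {i = i} ei x∈
  xj = toggle-star {c = c} {i = j} ej x∈
  xij = toggle-star {c = c} {i = j} ej xi

-- The bound on fibres is assumed for every duplicate-free list `M` inside a fibre, so that it
-- passes to the sublist left after one fibre is removed.
fibre-bound : (f : A → B) → DecidableEquality B → ∀ {K} {L : List A} (ys : List B) →
  Unique L → (∀ {a} → a ∈ L → f a ∈ ys) →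
  (∀ b {M} → Unique M → (∀ {a} → a ∈ M → a ∈ L × f a ≡ b) → length M ≤ K) →
  length L ≤ length ys * K
fibre-bound f _≟_ {L = []} [] _ _ _ = z≤n
fibre-bound f _≟_ {L = _ ∷ _} [] _ f∈ _ with f∈ (here refl)
... | ()
fibre-bound f _≟_ {K} {L} (y ∷ ys) L! f∈ small = begin
  length L ≡⟨ filter-complement over? L ⟩
  length (filter over? L) + length (filter (¬? ∘ over?) L)
    ≤⟨ ℕ.+-mono-≤
        (small y (Unique.filter⁺ over? L!) (∈-filter⁻ over? {xs = L}))
        (fibre-bound f _≟_ ys (Unique.filter⁺ (¬? ∘ over?) L!) elsewhere
          (λ b M! M⊆ → small b M! λ a∈ →
            proj₁ (∈-filter⁻ (¬? ∘ over?) {xs = L} (proj₁ (M⊆ a∈))) , proj₂ (M⊆ a∈))) ⟩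
  K + length ys * K ∎
  where
  open ℕ.≤-Reasoning
  over? : ∀ a → Dec (f a ≡ y)
  over? a = f a ≟ y
  elsewhere : ∀ {a} → a ∈ filter (¬? ∘ over?) L → f a ∈ ys
  elsewhere a∈ with ∈-filter⁻ (¬? ∘ over?) {xs = L} a∈
  ... | a∈L , fa≢y with f∈ a∈L
  ...   | here fa≡y = contradiction fa≡y fa≢y
  ...   | there fa∈ys = fa∈ys

length-cartesianProductWith : {D : Set} (f : A → B → D) (xs : List A) (ys : List B) →
  length (cartesianProductWith f xs ys) ≡ length xs * length ys
length-cartesianProductWith f [] ys = refl
length-cartesianProductWith f (x ∷ xs) ys = trans (length-++ (map (f x) ys))
  (cong₂ _+_ (length-map (f x) ys) (length-cartesianProductWith f xs ys))

-- Double counting of flags, that is, cubes with one of their `2 ^ suc ℓ` vertices. Here `k` is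
-- `suc (suc p)`: a linked path on `k` directions is a `2k`-cycle, so `clique-bound` applies with
-- `suc p` at each vertex.
cubes-bound : (S : Subgraph (Q n)) → ∀ ℓ p → ¬ HasCycle S (2 * suc (suc p)) →
  length (cubesIn S (suc ℓ)) * 2 ^ suc ℓ ≤ 2 ^ n * (n * 2 ^ suc p)
cubes-bound {n} S ℓ p ¬cycle = subst₂ _≤_
  (trans (length-cartesianProductWith _,_ (cubesIn S (suc ℓ)) _)
    (cong (length (cubesIn S (suc ℓ)) *_) (length-vertices (suc ℓ))))
  (cong (_* (n * 2 ^ suc p)) (length-vertices n))
  (fibre-bound place _≟ᵛ_ {L = flags} (vertices n)
    (Unique.cartesianProduct⁺ (Unique.filter⁺ (inside? S) (cubes-unique n (suc ℓ))) (vertices-unique (suc ℓ)))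
    (λ _ → ∈-vertices _) at-vertex)
  where
  Flag = Cube n (suc ℓ) × Vertex (suc ℓ)
  flags : List Flag
  flags = cartesianProduct (cubesIn S (suc ℓ)) (vertices (suc ℓ))
  place : Flag → Vertex n
  place (c , t) = fill c t
  at-vertex : ∀ x {M} → Unique M → (∀ {a} → a ∈ M → a ∈ flags × place a ≡ x) → length M ≤ n * 2 ^ suc p
  at-vertex x {M} M! M⊆ = subst (_≤ n * 2 ^ suc p) (length-map (stars ∘ proj₁) M)
    (clique-bound (linked? S x) (suc p) (λ path is! len → ¬cycle (linked-path⇒cycle S x path is! len))
      n (allFin n) (ℕ.≤-reflexive (length-tabulate id))
      (map-unique stars-determine M!) cliques)
    where
    through : ∀ {c t} → (c , t) ∈ M → x ∈ᶜ c
    through {c} {t} ∈M = subst (_∈ᶜ c) (proj₂ (M⊆ ∈M)) (fill-∈ c t)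
    stars-determine : ∀ {a b} → a ∈ M → b ∈ M → stars (proj₁ a) ≡ stars (proj₁ b) → a ≡ b
    stars-determine {c , s} {c′ , t} a∈ b∈ eq with stars-injective (through a∈) (through b∈) eq
    ... | refl = cong (c ,_) (fill-injective c (trans (proj₂ (M⊆ a∈)) (sym (proj₂ (M⊆ b∈)))))
    cliques : ∀ {D} → D ∈ map (stars ∘ proj₁) M → Clique (linked? S x) (suc p) _ (allFin n) D
    cliques D∈ with ∈-map⁻ (stars ∘ proj₁) D∈
    ... | (c , t) , ∈M , refl = clique (star c) (λ _ → ∈-allFin _)
      (inside-linked (proj₂ (∈-filter⁻ (inside? S) {xs = cubes n (suc ℓ)}
        (proj₁ (∈-cartesianProduct⁻ (cubesIn S (suc ℓ)) (vertices (suc ℓ)) (proj₁ (M⊆ ∈M))))))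
        (through ∈M))

-- Parallel cubes

-- The disjoint union of the 2 ^ r parallel copies of Q m obtained by freezing the last r coordinates.
parallel : ∀ m r → Subgraph (Q (m + r))
parallel m r = record
  { vs = λ _ → true
  ; es = λ u v → adj (Q _) u v ∧ does (Vec.drop m u ≟ᵛ Vec.drop m v)
  ; es-sym = λ u v → cong₂ _∧_ (Q-sym u v) (bool-ext
      (λ e → dec-true (Vec.drop m v ≟ᵛ Vec.drop m u) (sym (witness (Vec.drop m u ≟ᵛ Vec.drop m v) e)))
      (λ e → dec-true (Vec.drop m u ≟ᵛ Vec.drop m v) (sym (witness (Vec.drop m v ≟ᵛ Vec.drop m u) e))))
  ; es-adj = λ u v e → proj₁ (∧-true e)
  ; es-vs = λ _ _ _ → refl }

∨-introˡ : ∀ {b c} → b ≡ true → b ∨ c ≡ true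
∨-introˡ refl = refl

parallel-acyclic : ∀ m r s → 2 ^ m < s → ¬ HasCycle (parallel m r) s
parallel-acyclic m r (suc s) 2^m<s (h , isCycle inj _ hes) = ℕ.<⇒≱ 2^m<s
  (subst₂ _≤_ (length-tabulate (Vec.take m ∘ h)) (length-vertices m)
    (unique⇒length≤ (Unique.tabulate⁺ {f = Vec.take m ∘ h} take-injective) (λ _ → ∈-vertices _)))
  where
  step : ∀ i → Vec.drop m (h (Fin.inject₁ i)) ≡ Vec.drop m (h (suc i))
  step i = witness (_ ≟ᵛ _) (proj₂ (∧-true {adj (Q _) (h (Fin.inject₁ i)) (h (suc i))}
    (hes (Fin.inject₁ i) (suc i) (∨-introˡ consecutive))))
    where
    consecutive : (suc (toℕ (Fin.inject₁ i)) ≡ᵇ toℕ (suc i)) ≡ true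
    consecutive = Equivalence.to Bool.T-≡ (ℕ.≡⇒≡ᵇ (toℕ (Fin.inject₁ i)) (toℕ i) (Fin.toℕ-inject₁ i))
  constant : ∀ i → Vec.drop m (h i) ≡ Vec.drop m (h zero)
  constant = <-weakInduction (λ i → Vec.drop m (h i) ≡ Vec.drop m (h zero)) refl
    (λ i eq → trans (sym (step i)) eq)
  take-injective : ∀ {i j} → Vec.take m (h i) ≡ Vec.take m (h j) → i ≡ j
  take-injective {i} {j} eq = inj i j (begin
    h i ≡⟨ Vec.take++drop≡id m (h i) ⟨
    Vec.take m (h i) Vec.++ Vec.drop m (h i)
      ≡⟨ cong₂ Vec._++_ eq (trans (constant i) (sym (constant j))) ⟩
    Vec.take m (h j) Vec.++ Vec.drop m (h j) ≡⟨ Vec.take++drop≡id m (h j) ⟩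
    h j ∎)
    where open ≡-Reasoning

freeze : Cube m ℓ → Vertex n → Cube (m + n) ℓ
freeze [] w = proj₁ (point w)
freeze (b ∷ c) w = b ∷ freeze c w
freeze (✶∷ c) w = ✶∷ freeze c w

∷-cube-injective : {b b′ : Bool} {c c′ : Cube n ℓ} →
  _≡_ {A = Cube (suc n) ℓ} (b ∷ c) (b′ ∷ c′) → b ≡ b′ × c ≡ c′
∷-cube-injective refl = refl , refl

✶∷-injective : {c c′ : Cube n ℓ} → ✶∷ c ≡ ✶∷ c′ → c ≡ c′
✶∷-injective refl = refl

freeze-injective : {c c′ : Cube m ℓ} {w w′ : Vertex n} → freeze c w ≡ freeze c′ w′ → c ≡ c′ × w ≡ w′
freeze-injective {c = []} {[]} {w} {w′} eq =
  refl , point-∈ (proj₂ (point w)) (subst (w′ ∈ᶜ_) (sym eq) (proj₂ (point w′)))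
freeze-injective {c = b ∷ c} {b′ ∷ c′} eq =
  let (b≡b′ , eq′) = ∷-cube-injective eq ; (c≡c′ , w≡w′) = freeze-injective eq′ in
  cong₂ _∷_ b≡b′ c≡c′ , w≡w′
freeze-injective {c = b ∷ c} {✶∷ c′} ()
freeze-injective {c = ✶∷ c} {b′ ∷ c′} ()
freeze-injective {c = ✶∷ c} {✶∷ c′} eq =
  let (c≡c′ , w≡w′) = freeze-injective (✶∷-injective eq) in cong ✶∷_ c≡c′ , w≡w′

drop-freeze : (c : Cube m ℓ) (w : Vertex n) (t : Vertex ℓ) → Vec.drop m (fill (freeze c w) t) ≡ w
drop-freeze [] w t = point-∈ (fill-∈ (proj₁ (point w)) t) (proj₂ (point w))
drop-freeze (b ∷ c) w t = drop-freeze c w t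
drop-freeze (✶∷ c) w (b ∷ t) = drop-freeze c w t

freeze-inside : ∀ (c : Cube m ℓ) (w : Vertex n) → Inside (parallel m n) (freeze c w)
freeze-inside {m} c w = (λ _ → refl) , λ s t s~t → cong₂ _∧_ (trans (fill-adj (freeze c w) s t) s~t)
  (dec-true (_ ≟ᵛ _) (trans (drop-freeze c w s) (sym (drop-freeze c w t))))

parallel-count : ∀ m r ℓ → length (cubes m ℓ) * 2 ^ r ≤ length (cubesIn (parallel m r) ℓ)
parallel-count m r ℓ = subst (_≤ length (cubesIn (parallel m r) ℓ))
  (trans (length-cartesianProductWith freeze (cubes m ℓ) (vertices r)) (cong (length (cubes m ℓ) *_) (length-vertices r)))
  (unique⇒length≤
    (Unique.cartesianProductWith⁺ freeze freeze-injective (cubes-unique m ℓ) (vertices-unique r))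
    λ c∈ → let (c , w , _ , _ , eq) = ∈-cartesianProductWith⁻ freeze (cubes m ℓ) (vertices r) c∈ in
      subst (_∈ cubesIn (parallel m r) ℓ) (sym eq)
        (∈-filter⁺ (inside? (parallel m r)) (∈-cubes (freeze c w)) (freeze-inside c w)))

-- Densities

C-absorb : ∀ n k → suc k * (suc n C suc k) ≡ suc n * (n C k)
C-absorb zero zero = refl
C-absorb zero (suc k) = ℕ.*-zeroʳ k
C-absorb (suc n) k = begin
  suc k * (suc (suc n) C suc k) ≡⟨ cong (suc k *_) (nCk+nC[k+1]≡[n+1]C[k+1] (suc n) k) ⟨
  suc k * (suc n C k + suc n C suc k) ≡⟨ ℕ.*-distribˡ-+ (suc k) (suc n C k) _ ⟩
  suc k * (suc n C k) + suc k * (suc n C suc k) ≡⟨ cong (λ a → suc k * (suc n C k) + a) (C-absorb n k) ⟩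
  suc k * (suc n C k) + suc n * (n C k) ≡⟨ lower k ⟩
  suc (suc n) * (suc n C k) ∎
  where
  open ≡-Reasoning
  regroup : ∀ a b c n → a + n * b + n * c ≡ a + n * (b + c)
  regroup = solve-∀
  lower : ∀ k → suc k * (suc n C k) + suc n * (n C k) ≡ suc (suc n) * (suc n C k)
  lower zero = refl
  lower (suc j) = begin
    (suc n C suc j + suc j * (suc n C suc j)) + suc n * (n C suc j)
      ≡⟨ cong (λ a → suc n C suc j + a + suc n * (n C suc j)) (C-absorb n j) ⟩
    suc n C suc j + suc n * (n C j) + suc n * (n C suc j) ≡⟨ regroup (suc n C suc j) (n C j) _ (suc n) ⟩
    suc n C suc j + suc n * (n C j + n C suc j)
      ≡⟨ cong (λ a → suc n C suc j + suc n * a) (nCk+nC[k+1]≡[n+1]C[k+1] n j) ⟩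
    suc (suc n) * (suc n C suc j) ∎

C-positive : ∀ {n k} → k ≤ n → 1 ≤ n C k
C-positive {k = zero} _ = ℕ.≤-refl
C-positive {suc n} {suc k} (s≤s k≤n) = subst (1 ≤_) (nCk+nC[k+1]≡[n+1]C[k+1] n k)
  (ℕ.≤-trans (C-positive k≤n) (ℕ.m≤m+n _ _))

-- Absorbing twice gives `n (n - 1) C(n-2, ℓ-2) = ℓ (ℓ - 1) C(n, ℓ)`; then `C(n-2, ℓ-2) ≥ 1` and `n
-- ≤ 2 (n - 1)` are used.
square≤C : ∀ {n ℓ} → 2 ≤ ℓ → ℓ ≤ n → n * n ≤ 2 * (ℓ * ℓ) * (n C ℓ)
square≤C {ℓ = suc zero} (s≤s ())
square≤C {suc (suc n)} {suc (suc ℓ)} _ (s≤s (s≤s ℓ≤n)) = begin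
  suc (suc n) * suc (suc n) ≤⟨ ℕ.*-monoʳ-≤ (suc (suc n)) half ⟩
  suc (suc n) * (2 * (suc n * (n C ℓ))) ≡⟨ cong (λ a → suc (suc n) * (2 * a)) (C-absorb n ℓ) ⟨
  suc (suc n) * (2 * (suc ℓ * (suc n C suc ℓ))) ≡⟨ shuffle (suc (suc n)) (suc ℓ) (suc n C suc ℓ) ⟩
  2 * suc ℓ * (suc (suc n) * (suc n C suc ℓ)) ≡⟨ cong (2 * suc ℓ *_) (C-absorb (suc n) (suc ℓ)) ⟨
  2 * suc ℓ * (suc (suc ℓ) * (suc (suc n) C suc (suc ℓ)))
    ≡⟨ regroup (suc ℓ) (suc (suc ℓ)) (suc (suc n) C suc (suc ℓ)) ⟩
  2 * (suc ℓ * suc (suc ℓ)) * (suc (suc n) C suc (suc ℓ))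
    ≤⟨ ℕ.*-monoˡ-≤ (suc (suc n) C suc (suc ℓ)) (ℕ.*-monoʳ-≤ 2 (ℕ.*-monoˡ-≤ (suc (suc ℓ)) (ℕ.n≤1+n (suc ℓ)))) ⟩
  2 * (suc (suc ℓ) * suc (suc ℓ)) * (suc (suc n) C suc (suc ℓ)) ∎
  where
  open ℕ.≤-Reasoning
  shuffle : ∀ a b c → a * (2 * (b * c)) ≡ 2 * b * (a * c)
  shuffle = solve-∀
  regroup : ∀ a b c → 2 * a * (b * c) ≡ 2 * (a * b) * c
  regroup = solve-∀
  half : suc (suc n) ≤ 2 * (suc n * (n C ℓ))
  half = begin
    suc (suc n) ≤⟨ s≤s (ℕ.m≤n+m (suc n) n) ⟩
    suc n + suc n ≡⟨ cong (suc n +_) (ℕ.+-identityʳ (suc n)) ⟨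
    2 * suc n ≡⟨ cong (2 *_) (ℕ.*-identityʳ (suc n)) ⟨
    2 * (suc n * 1) ≤⟨ ℕ.*-monoʳ-≤ 2 (ℕ.*-monoʳ-≤ (suc n) (C-positive ℓ≤n)) ⟩
    2 * (suc n * (n C ℓ)) ∎

n<2^n : ∀ n → n < 2 ^ n
n<2^n zero = s≤s z≤n
n<2^n (suc n) = begin-strict
  suc n ≤⟨ n<2^n n ⟩
  2 ^ n <⟨ ℕ.^-monoʳ-< 2 (s≤s (s≤s z≤n)) (ℕ.n<1+n n) ⟩
  2 ^ suc n ∎
  where open ℕ.≤-Reasoning

2^-cancel-≤ : ∀ {a b} → 2 ^ a < 2 ^ b → a ≤ b
2^-cancel-≤ {a} {b} lt = ℕ.≮⇒≥ λ b<a → ℕ.<⇒≱ lt (ℕ.^-monoʳ-≤ 2 (ℕ.<⇒≤ b<a))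

-- Otherwise monotonicity of the logarithm gives `a ≤ a ∸ 1` for `a = ⌈log₂ s ⌉`, which is
-- impossible since `2 ≤ s` forces `1 ≤ a`.
2^⌈log₂⌉∸1< : ∀ {s} → 2 ≤ s → 2 ^ (⌈log₂ s ⌉ ∸ 1) < s
2^⌈log₂⌉∸1< {s} 2≤s = ℕ.≰⇒> λ s≤ → go ⌈log₂ s ⌉
  (subst (_≤ ⌈log₂ s ⌉) (⌈log₂2^n⌉≡n 1) (⌈log₂⌉-mono-≤ 2≤s))
  (subst (⌈log₂ s ⌉ ≤_) (⌈log₂2^n⌉≡n (⌈log₂ s ⌉ ∸ 1)) (⌈log₂⌉-mono-≤ s≤))
  where
  go : ∀ a → 1 ≤ a → ¬ (a ≤ a ∸ 1)
  go (suc a) _ a<a = ℕ.<-irrefl refl a<a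

⌈log₂⌉∸1≤ : ∀ {s n} → s ≤ 2 ^ n → ⌈log₂ s ⌉ ∸ 1 ≤ n
⌈log₂⌉∸1≤ {s} {n} s≤ = ℕ.≤-trans (ℕ.m∸n≤m _ 1) (subst (⌈log₂ s ⌉ ≤_) (⌈log₂2^n⌉≡n n) (⌈log₂⌉-mono-≤ s≤))

-- From inequalities of naturals to rationals

toℚᵘ-/ : ∀ a N → ℚ.toℚᵘ (ℤ.+ a ℚ./ suc N) ℚᵘ.≃ ℚᵘ.mkℚᵘ (ℤ.+ a) N
toℚᵘ-/ a N = ℚ.toℚᵘ-fromℚᵘ (ℚᵘ.mkℚᵘ (ℤ.+ a) N)

toℚᵘ-/* : ∀ a N x → ℚ.toℚᵘ ((ℤ.+ a ℚ./ suc N) ℚ.* ℕ→ℚ x) ℚᵘ.≃ ℚᵘ.mkℚᵘ (ℤ.+ a) N ℚᵘ.* ℚᵘ.mkℚᵘ (ℤ.+ x) 0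
toℚᵘ-/* a N x = ℚᵘ.≃-trans (ℚ.toℚᵘ-homo-* (ℤ.+ a ℚ./ suc N) (ℕ→ℚ x)) (ℚᵘ.*-cong (toℚᵘ-/ a N) (toℚᵘ-/ x 0))

-- Division in `ℚ` reduces the fraction, so the cross-multiplication takes place among unnormalised
-- rationals, where numerator and denominator stay visible.
/*-≤ : ∀ a b x N .{{_ : NonZero N}} → a * x ≤ b * N → ((ℤ.+ a ℚ./ N) ℚ.* ℕ→ℚ x) ℚ.≤ ℕ→ℚ b
/*-≤ a b x (suc N) le = ℚ.toℚᵘ-cancel-≤
  (ℚᵘ.≤-respˡ-≃ (ℚᵘ.≃-sym (toℚᵘ-/* a N x)) (ℚᵘ.≤-respʳ-≃ (ℚᵘ.≃-sym (toℚᵘ-/ b 0)) (ℚᵘ.*≤* (begin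
    (ℤ.+ a ℤ.* ℤ.+ x) ℤ.* ℤ.+ 1 ≡⟨ ℤ.*-identityʳ _ ⟩
    ℤ.+ a ℤ.* ℤ.+ x ≡⟨ ℤ.pos-* a x ⟨
    ℤ.+ (a * x) ≤⟨ ℤ.+≤+ le ⟩
    ℤ.+ (b * suc N) ≡⟨ cong (λ M → ℤ.+ (b * M)) (ℕ.*-identityʳ (suc N)) ⟨
    ℤ.+ (b * (suc N * 1)) ≡⟨ ℤ.pos-* b (suc N * 1) ⟩
    ℤ.+ b ℤ.* ℤ.+ (suc N * 1) ∎))))
  where open ℤ.≤-Reasoning

/*-≥ : ∀ a b x N .{{_ : NonZero N}} → b * N ≤ a * x → ℕ→ℚ b ℚ.≤ ((ℤ.+ a ℚ./ N) ℚ.* ℕ→ℚ x)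
/*-≥ a b x (suc N) le = ℚ.toℚᵘ-cancel-≤
  (ℚᵘ.≤-respʳ-≃ (ℚᵘ.≃-sym (toℚᵘ-/* a N x)) (ℚᵘ.≤-respˡ-≃ (ℚᵘ.≃-sym (toℚᵘ-/ b 0)) (ℚᵘ.*≤* (begin
    ℤ.+ b ℤ.* ℤ.+ (suc N * 1) ≡⟨ ℤ.pos-* b (suc N * 1) ⟨
    ℤ.+ (b * (suc N * 1)) ≡⟨ cong (λ M → ℤ.+ (b * M)) (ℕ.*-identityʳ (suc N)) ⟩
    ℤ.+ (b * suc N) ≤⟨ ℤ.+≤+ le ⟩
    ℤ.+ (a * x) ≡⟨ ℤ.pos-* a x ⟩
    ℤ.+ a ℤ.* ℤ.+ x ≡⟨ ℤ.*-identityʳ _ ⟨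
    (ℤ.+ a ℤ.* ℤ.+ x) ℤ.* ℤ.+ 1 ∎))))
  where open ℤ.≤-Reasoning

module _ {q : ℚ} (0≤q : 0ℚ ℚ.≤ q) where

  private instance
    q-nonNeg : ℚ.NonNegative q
    q-nonNeg = ℚ.nonNegative 0≤q

  ^ℚ-nonNeg : ∀ j → 0ℚ ℚ.≤ q ^ℚ j
  ^ℚ-nonNeg zero = ℚ.nonNegative⁻¹ ℚ.1ℚ
  ^ℚ-nonNeg (suc j) = subst (ℚ._≤ q ^ℚ suc j) (ℚ.*-zeroʳ q) (ℚ.*-monoˡ-≤-nonNeg q (^ℚ-nonNeg j))

  ^ℚ-≤1 : q ℚ.≤ ℚ.1ℚ → ∀ j → q ^ℚ j ℚ.≤ ℚ.1ℚ
  ^ℚ-≤1 q≤1 zero = ℚ.≤-refl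
  ^ℚ-≤1 q≤1 (suc j) = ℚ.≤-trans
    (subst (q ^ℚ suc j ℚ.≤_) (ℚ.*-identityʳ q) (ℚ.*-monoˡ-≤-nonNeg q (^ℚ-≤1 q≤1 j))) q≤1

  ^ℚ-≥1 : ℚ.1ℚ ℚ.≤ q → ∀ j → ℚ.1ℚ ℚ.≤ q ^ℚ j
  ^ℚ-≥1 1≤q zero = ℚ.≤-refl
  ^ℚ-≥1 1≤q (suc j) = ℚ.≤-trans 1≤q
    (subst (ℚ._≤ q ^ℚ suc j) (ℚ.*-identityʳ q) (ℚ.*-monoˡ-≤-nonNeg q (^ℚ-≥1 1≤q j)))

  ^ℚ-decreasing : q ℚ.≤ ℚ.1ℚ → ∀ j → q ^ℚ suc j ℚ.≤ q
  ^ℚ-decreasing q≤1 j = subst (q ^ℚ suc j ℚ.≤_) (ℚ.*-identityʳ q) (ℚ.*-monoˡ-≤-nonNeg q (^ℚ-≤1 q≤1 j))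

  ^ℚ-increasing : ℚ.1ℚ ℚ.≤ q → ∀ j → q ℚ.≤ q ^ℚ suc j
  ^ℚ-increasing 1≤q j = subst (ℚ._≤ q ^ℚ suc j) (ℚ.*-identityʳ q) (ℚ.*-monoˡ-≤-nonNeg q (^ℚ-≥1 1≤q j))

-- The density bounds

some-cube : ∀ {n ℓ} → ℓ ≤ n → Cube n ℓ
some-cube {zero} z≤n = []
some-cube {suc n} z≤n = true ∷ some-cube {n} z≤n
some-cube (s≤s ℓ≤n) = ✶∷ some-cube ℓ≤n

copies : ℕ → ℕ → ℕ
copies n ℓ = length (cubesIn (full n) ℓ)

copies≡ : ∀ n ℓ → copies n ℓ ≡ length (cubes n ℓ)
copies≡ n ℓ = cong length (filter-all (inside? (full n))
  (All.universal (λ c → (λ _ → refl) , λ s t e → trans (fill-adj c s t) e) (cubes n ℓ)))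

copies-nonZero : ∀ {n ℓ} → ℓ ≤ n → NonZero (copies n ℓ)
copies-nonZero {n} {ℓ} ℓ≤n = subst NonZero (sym (copies≡ n ℓ)) (inhabited (∈-cubes (some-cube ℓ≤n)))
  where
  inhabited : ∀ {c : Cube n ℓ} {L} → c ∈ L → NonZero (length L)
  inhabited (here _) = _
  inhabited (there _) = _

extremal-subgraph : ∀ k ℓ n → 1 ≤ k → ∃ λ (S : Subgraph (Q n)) → ¬ HasCycle S (2 * k)
  × (∀ (S′ : Subgraph (Q n)) → ¬ HasCycle S′ (2 * k) → length (cubesIn S′ ℓ) ≤ length (cubesIn S ℓ))
extremal-subgraph (suc k) ℓ n _ = extremal n ℓ (k + suc (k + 0))

zero-density : ∀ k ℓ n → 2 ≤ k → ℓ ≤ n → 2 * k ≤ 2 ^ ℓ → IsDensity (Q n) (Q ℓ) (Cyc (2 * k)) 0ℚ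
zero-density k ℓ n 2≤k ℓ≤n le =
  let 1≤k = ℕ.≤-trans (s≤s z≤n) 2≤k
      (S , free , max) = extremal-subgraph k ℓ n 1≤k
      none = cong length (empty (cubesIn S ℓ) λ {c} c∈ →
        free (cycle-inside {c = c} (proj₂ (∈-filter⁻ (inside? S) {xs = cubes n ℓ} c∈)) (even-cycle 1≤k le)))
  in 0 , copies n ℓ , subst (IsEx (Q n) (Q ℓ) (Cyc (2 * k))) none (isEx S free max)
    , count-copies (Q-realizes-full n) ℓ
    , copies-nonZero {n} {ℓ} ℓ≤n , sym (ℚ.0/n≡0 (copies n ℓ) {{copies-nonZero {n} {ℓ} ℓ≤n}})
  where
  empty : (L : List (Cube n ℓ)) → (∀ {c} → ¬ c ∈ L) → L ≡ []
  empty [] _ = refl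
  empty (c ∷ _) none = contradiction (here refl) none

-- After multiplication by `2 ^ ℓ`, `length-cubes` evaluates both cube counts, and `2 ^ (m + r)`
-- splits to match the `2 ^ r` parallel copies.
lower-bound : ∀ {n ℓ m e} → m ≤ n → (∀ r → m + r ≡ n → length (cubes m ℓ) * 2 ^ r ≤ e) →
  (m C ℓ) * copies n ℓ ≤ e * (n C ℓ)
lower-bound {n} {ℓ} {m} {e} m≤n many with ℕ.m≤n⇒∃[o]m+o≡n m≤n
... | r , refl = ℕ.*-cancelʳ-≤ _ _ (2 ^ ℓ) {{ℕ.m^n≢0 2 ℓ}} (begin
  (m C ℓ) * copies n ℓ * 2 ^ ℓ ≡⟨ ℕ.*-assoc (m C ℓ) _ _ ⟩
  (m C ℓ) * (copies n ℓ * 2 ^ ℓ)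
    ≡⟨ cong ((m C ℓ) *_) (trans (cong (_* 2 ^ ℓ) (copies≡ n ℓ)) (length-cubes n ℓ)) ⟩
  (m C ℓ) * (2 ^ (m + r) * (n C ℓ)) ≡⟨ cong (λ a → (m C ℓ) * (a * (n C ℓ))) (ℕ.^-distribˡ-+-* 2 m r) ⟩
  (m C ℓ) * (2 ^ m * 2 ^ r * (n C ℓ)) ≡⟨ regroup (m C ℓ) (2 ^ m) (2 ^ r) (n C ℓ) ⟩
  2 ^ m * (m C ℓ) * (2 ^ r * (n C ℓ)) ≡⟨ cong (_* (2 ^ r * (n C ℓ))) (length-cubes m ℓ) ⟨
  length (cubes m ℓ) * 2 ^ ℓ * (2 ^ r * (n C ℓ)) ≡⟨ shuffle (length (cubes m ℓ)) (2 ^ ℓ) (2 ^ r) (n C ℓ) ⟩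
  length (cubes m ℓ) * 2 ^ r * (n C ℓ) * 2 ^ ℓ
    ≤⟨ ℕ.*-monoˡ-≤ (2 ^ ℓ) (ℕ.*-monoˡ-≤ (n C ℓ) (many r refl)) ⟩
  e * (n C ℓ) * 2 ^ ℓ ∎)
  where
  open ℕ.≤-Reasoning
  regroup : ∀ a b c d → a * (b * c * d) ≡ b * a * (c * d)
  regroup = solve-∀
  shuffle : ∀ a b c d → a * b * (c * d) ≡ a * c * d * b
  shuffle = solve-∀

upper-bound : ∀ {n ℓ e s p} → 2 ≤ ℓ → ℓ ≤ n → ℓ ≤ s → e * 2 ^ ℓ ≤ 2 ^ n * (n * 2 ^ p) →
  e * n ≤ 2 * (s * s) * 2 ^ p * copies n ℓ
upper-bound {n} {ℓ} {e} {s} {p} 2≤ℓ ℓ≤n ℓ≤s few = ℕ.*-cancelʳ-≤ _ _ (2 ^ ℓ) {{ℕ.m^n≢0 2 ℓ}} (begin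
  e * n * 2 ^ ℓ ≡⟨ swap e n (2 ^ ℓ) ⟩
  e * 2 ^ ℓ * n ≤⟨ ℕ.*-monoˡ-≤ n few ⟩
  2 ^ n * (n * 2 ^ p) * n ≡⟨ collect (2 ^ n) n (2 ^ p) ⟩
  n * n * (2 ^ n * 2 ^ p) ≤⟨ ℕ.*-monoˡ-≤ (2 ^ n * 2 ^ p) (square≤C 2≤ℓ ℓ≤n) ⟩
  2 * (ℓ * ℓ) * (n C ℓ) * (2 ^ n * 2 ^ p)
    ≤⟨ ℕ.*-monoˡ-≤ (2 ^ n * 2 ^ p) (ℕ.*-monoˡ-≤ (n C ℓ) (ℕ.*-monoʳ-≤ 2 (ℕ.*-mono-≤ ℓ≤s ℓ≤s))) ⟩
  2 * (s * s) * (n C ℓ) * (2 ^ n * 2 ^ p) ≡⟨ regroup (2 * (s * s)) (n C ℓ) (2 ^ n) (2 ^ p) ⟩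
  2 * (s * s) * 2 ^ p * (2 ^ n * (n C ℓ))
    ≡⟨ cong (2 * (s * s) * 2 ^ p *_) (trans (cong (_* 2 ^ ℓ) (copies≡ n ℓ)) (length-cubes n ℓ)) ⟨
  2 * (s * s) * 2 ^ p * (copies n ℓ * 2 ^ ℓ) ≡⟨ ℕ.*-assoc (2 * (s * s) * 2 ^ p) _ _ ⟨
  2 * (s * s) * 2 ^ p * copies n ℓ * 2 ^ ℓ ∎)
  where
  open ℕ.≤-Reasoning
  swap : ∀ a b c → a * b * c ≡ a * c * b
  swap = solve-∀
  collect : ∀ a b c → a * (b * c) * b ≡ b * b * (a * c)
  collect = solve-∀
  regroup : ∀ a b c d → a * b * (c * d) ≡ a * d * (c * b)
  regroup = solve-∀

-- The factor `2 ^ (k ∸ 1)` comes from the clique bound and the rest from `square≤C`, with `ℓ`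
-- replaced by `2 * k` in view of `ℓ < 2 ^ ℓ < 2 * k`.
densityConstant : ℕ → ℕ
densityConstant k = 2 * (2 * k * (2 * k)) * 2 ^ (k ∸ 1)

densityConstant-positive : ∀ k → 1 ≤ k → 1 ≤ densityConstant k
densityConstant-positive k@(suc _) _ = ℕ.*-mono-≤ {1} {2 * (2 * k * (2 * k))} (s≤s z≤n) (ℕ.m^n>0 2 (k ∸ 1))

counting-bounds : ∀ k ℓ n → 2 ≤ k → 2 ≤ ℓ → 2 ^ ℓ < 2 * k → 2 * k ≤ 2 ^ n →
  ∃ λ e → IsEx (Q n) (Q ℓ) (Cyc (2 * k)) e × e ≤ copies n ℓ
    × ((⌈log₂ (2 * k) ⌉ ∸ 1) C ℓ) * copies n ℓ ≤ e * (n C ℓ)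
    × e * n ≤ densityConstant k * copies n ℓ
counting-bounds (suc zero) _ _ (s≤s ())
counting-bounds k@(suc (suc p)) (suc ℓ) n 2≤k 2≤ℓ 2^ℓ<2k 2k≤2^n =
  let (S , free , max) = extremal-subgraph k (suc ℓ) n (s≤s z≤n)
      ℓ≤n = 2^-cancel-≤ (ℕ.<-≤-trans 2^ℓ<2k 2k≤2^n)
      ℓ≤2k = ℕ.<⇒≤ (ℕ.<-trans (n<2^n (suc ℓ)) 2^ℓ<2k)
      m = ⌈log₂ (2 * k) ⌉ ∸ 1
      2^m<2k = 2^⌈log₂⌉∸1< (ℕ.*-mono-≤ {2} {2} {1} {k} ℕ.≤-refl (s≤s z≤n))
      e = length (cubesIn S (suc ℓ))
  in e , isEx S free max
    , subst (e ≤_) (sym (copies≡ n (suc ℓ))) (length-filter (inside? S) (cubes n (suc ℓ)))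
    , lower-bound {n} {suc ℓ} {m} {e} (⌈log₂⌉∸1≤ 2k≤2^n) (λ { r refl →
        ℕ.≤-trans (parallel-count m r (suc ℓ)) (max (parallel m r) (parallel-acyclic m r (2 * k) 2^m<2k)) })
    , upper-bound {n} {suc ℓ} {e} {2 * k} {suc p} 2≤ℓ ℓ≤n ℓ≤2k (cubes-bound S ℓ p free)

density : ∀ k ℓ n → 2 ≤ k → 2 ≤ ℓ → 2 ^ ℓ < 2 * k → 2 * k ≤ 2 ^ n →
  Σ ℚ λ d → IsDensity (Q n) (Q ℓ) (Cyc (2 * k)) d × 0ℚ ℚ.≤ d × d ℚ.≤ ℚ.1ℚ
    × ℕ→ℚ ((⌈log₂ (2 * k) ⌉ ∸ 1) C ℓ) ℚ.≤ d ℚ.* ℕ→ℚ (n C ℓ)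
    × d ℚ.* ℕ→ℚ n ℚ.≤ ℕ→ℚ (densityConstant k)
density k ℓ n 2≤k 2≤ℓ 2^ℓ<2k 2k≤2^n =
  let (e , ex , e≤N , low , high) = counting-bounds k ℓ n 2≤k 2≤ℓ 2^ℓ<2k 2k≤2^n
      N = copies n ℓ
      instance N≢0 = copies-nonZero {n} {ℓ} (2^-cancel-≤ (ℕ.<-≤-trans 2^ℓ<2k 2k≤2^n))
      d = ℤ.+ e ℚ./ N
  in d , (e , N , ex , count-copies (Q-realizes-full n) ℓ , N≢0 , refl)
    , subst (0ℚ ℚ.≤_) (ℚ.*-identityʳ d) (/*-≥ e 0 1 N z≤n)
    , subst (ℚ._≤ ℚ.1ℚ) (ℚ.*-identityʳ d) (/*-≤ e 1 1 N
        (subst₂ _≤_ (sym (ℕ.*-identityʳ e)) (sym (ℕ.*-identityˡ N)) e≤N))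
    , /*-≥ e ((⌈log₂ (2 * k) ⌉ ∸ 1) C ℓ) (n C ℓ) N low
    , /*-≤ e (densityConstant k) n N high

theorem4 : (∀ (k ℓ n : ℕ) → 2 ≤ k → ℓ ≤ n → 2 * k ≤ 2 ^ ℓ →
    IsDensity (Q n) (Q ℓ) (Cyc (2 * k)) 0ℚ)
    × (∀ (k : ℕ) → 4 ≤ k → k ≢ 5 →
    Σ ℚ λ c → Positive c ×
    (∀ (ℓ n : ℕ) → 2 ≤ ℓ → 2 ^ ℓ < 2 * k → 2 * k ≤ 2 ^ n →
    Σ ℚ λ d → IsDensity (Q n) (Q ℓ) (Cyc (2 * k)) d
    × ℚ._≤_ (ℕ→ℚ ((⌈log₂ (2 * k) ⌉ ∸ 1) C ℓ)) (ℚ._*_ d (ℕ→ℚ (n C ℓ)))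
    × ℚ._≤_ (ℚ._*_ (d ^ℚ 16) (ℕ→ℚ n)) (c ^ℚ 16)))
theorem4 = zero-density , λ k 4≤k _ →
  let 2≤k = ℕ.≤-trans (s≤s (s≤s z≤n)) 4≤k
      c = ℕ→ℚ (densityConstant k)
      1≤c = subst (ℚ.1ℚ ℚ.≤_) (ℚ.*-identityʳ c) (/*-≥ (densityConstant k) 1 1 1
        (subst (1 ≤_) (sym (ℕ.*-identityʳ (densityConstant k))) (densityConstant-positive k (ℕ.≤-trans (s≤s z≤n) 2≤k))))
      0<c = ℚ.<-≤-trans (ℚ.positive⁻¹ ℚ.1ℚ) 1≤c
  in c , ℚ.positive 0<c , λ ℓ n 2≤ℓ 2^ℓ<2k 2k≤2^n →
    let (d , isDensity , 0≤d , d≤1 , low , high) = density k ℓ n 2≤k 2≤ℓ 2^ℓ<2k 2k≤2^n in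
    -- From `d * n ≤ c` to sixteenth powers: `0 ≤ d ≤ 1` makes `d ^ℚ 16 ≤ d`, and `1 ≤ c` makes
    -- `c ≤ c ^ℚ 16`.
    d , isDensity , low , ℚ.≤-trans
      (ℚ.*-monoʳ-≤-nonNeg (ℕ→ℚ n) {{ℚ.nonNegative (nonNeg n)}} (^ℚ-decreasing 0≤d d≤1 15))
      (ℚ.≤-trans high (^ℚ-increasing (ℚ.<⇒≤ 0<c) 1≤c 15))
  where
  nonNeg : ∀ n → 0ℚ ℚ.≤ ℕ→ℚ n
  nonNeg n = subst (0ℚ ℚ.≤_) (ℚ.*-identityʳ (ℕ→ℚ n)) (/*-≥ n 0 1 1 z≤n)
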